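{- Let $n \geq 2$ be an integer and let $r$ be a real number. Then $r$ is the asymptotic density of some $n$-c.e. set if and only if $r \in [0,1]$ and $r$ is a difference of two left-$\Pi^0_2$ reals (i.e. $r \in \mathcal{D}_2 \cap [0,1]$). Hence the set of reals which are asymptotic densities of $n$-c.e. sets equals the set of reals which are asymptotic densities of $2$-c.e. sets.
   Context: For $X \subseteq \omega=\{0,1,2,\dots\}$ and an integer $m>0$, let $\rho_m(X) = |\{j \in X : j < m\}|/m$. The set $X$ has a (asymptotic) density if $\lim_m \rho_m(X)$ exists, and the density is then $\rho(X) = \lim_m \rho_m(X)$. Saying that $r$ is the density of a set $X$ means that $X$ has a density and $\rho(X)=r$. Sets are identified with their characteristic functions. For a natural number $n$, a set $A \subseteq \omega$ is $n$-c.e. if there is a computable function $g:\omega\times\omega\to\{0,1\}$ such that for all $x$: $g(x,0)=0$, $A(x)=\lim_s g(x,s)$, and $|\{s : g(x,s) \neq g(x,s+1)\}| \leq n$. A real $r$ is left-$\Pi^0_2$ if its left Dedekind cut $\{q \in \mathbb{Q} : q < r\}$ is a $\Pi^0_2$ set. $\mathcal{D}_2$ is the set of all reals of the form $a-b$ where $a$ and $b$ are left-$\Pi^0_2$ reals. -}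

module Defs where

open import Level using (0ℓ)
open import Data.Bool using (Bool; true; false; _xor_; if_then_else_)
open import Data.Fin using (Fin)
open import Data.Nat as ℕ using (ℕ; zero; suc)
open import Data.Nat.Coprimality as Coprimality using (1-coprimeTo)
open import Data.Integer as ℤ using (ℤ; +_; -[1+_]; ∣_∣; +<+; -<+)
import Data.Integer.Properties as ℤ
open import Data.List using (length; filterᵇ; upTo)
open import Data.Product using (∃-syntax; _×_; _,_)
open import Data.Rational hiding (∣_∣)
open import Data.Rational.Properties
open import Data.Rational.Solver using (module +-*-Solver)
import Data.Rational.Unnormalised as ℚᵘ
import Data.Rational.Unnormalised.Properties as ℚᵘ
open import Data.Sum as Sum using (_⊎_; inj₁; inj₂; swap)
open import Data.Vec using (Vec; []; _∷_; lookup; tabulate)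
open import Function.Bundles using (_⇔_)
open import Relation.Nullary using (contradiction)
open import Relation.Unary using (Pred; _∈_; _∉_; Satisfiable)
open import Relation.Binary.PropositionalEquality
  using (_≡_; _≢_; refl; sym; trans; cong; subst; subst₂)

------------------------------------------------------------------------
-- Dedekind reals: q ∈ lower x means q < x, and q ∈ upper x means x < q.

record ℝ : Set₁ where
  field
    lower upper     : Pred ℚ 0ℓ
    lower-inhabited : Satisfiable lower
    upper-inhabited : Satisfiable upper
    lower-closed    : ∀ {p q} → p < q → q ∈ lower → p ∈ lower
    upper-closed    : ∀ {p q} → p < q → p ∈ upper → q ∈ upper
    lower-open      : ∀ {p} → p ∈ lower → ∃[ q ] p < q × q ∈ lower
    upper-open      : ∀ {q} → q ∈ upper → ∃[ p ] p < q × p ∈ upper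
    lower<upper     : ∀ {p q} → p ∈ lower → q ∈ upper → p < q
    located         : ∀ {p q} → p < q → p ∈ lower ⊎ q ∈ upper

open ℝ

infix 4 _≈_

_≈_ : ℝ → ℝ → Set
x ≈ y = (∀ q → q ∈ lower x ⇔ q ∈ lower y) × (∀ q → q ∈ upper x ⇔ q ∈ upper y)

infix 4 _∈[0,1]

_∈[0,1] : ℝ → Set
x ∈[0,1] = 0ℚ ∉ upper x × 1ℚ ∉ lower x

open +-*-Solver

⌜_⌝ : ℕ → ℚ
⌜ k ⌝ = mkℚ (+ k) 0 (Coprimality.sym (1-coprimeTo k))

⌜suc⌝ : ∀ k → ⌜ suc k ⌝ ≡ 1ℚ + ⌜ k ⌝
⌜suc⌝ k = toℚᵘ-injective (ℚᵘ.≃-trans eq (ℚᵘ.≃-sym (toℚᵘ-homo-+ 1ℚ ⌜ k ⌝)))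
  where
  eq : toℚᵘ ⌜ suc k ⌝ ℚᵘ.≃ toℚᵘ 1ℚ ℚᵘ.+ toℚᵘ ⌜ k ⌝
  eq = ℚᵘ.*≡* (cong (ℤ._* + 1) (sym (cong (ℤ._+_ (+ 1)) (ℤ.*-identityʳ (+ k)))))

<⌜⌝ : ∀ p → ∃[ k ] p < ⌜ k ⌝
<⌜⌝ p@(mkℚ n d-1 _) = suc ∣ n ∣ , *<* (ℤ.≤-<-trans (ℤ.≤-reflexive (ℤ.*-identityʳ n))
  (ℤ.<-≤-trans (n<1+∣n∣ n) (subst (ℤ._≤ + suc ∣ n ∣ ℤ.* + suc d-1)
    (ℤ.*-identityʳ (+ suc ∣ n ∣)) (ℤ.*-monoˡ-≤-nonNeg (+ suc ∣ n ∣) (ℤ.+≤+ (ℕ.s≤s ℕ.z≤n))))))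
  where
  open import Data.Nat.Properties using (n<1+n)
  n<1+∣n∣ : ∀ i → i ℤ.< + suc ∣ i ∣
  n<1+∣n∣ (+ i)    = +<+ (n<1+n i)
  n<1+∣n∣ -[1+ i ] = -<+

archimedean : ∀ d δ .{{_ : Positive δ}} → ∃[ k ] d < ⌜ k ⌝ * δ
archimedean d δ = let k , d/δ<k = <⌜⌝ (d * 1/ δ) in
  k , subst (_< ⌜ k ⌝ * δ) eq (*-monoˡ-<-pos δ d/δ<k)
  where
  instance _ = pos⇒nonZero δ
  eq : d * 1/ δ * δ ≡ d
  eq = trans (*-assoc d (1/ δ) δ) (trans (cong (d *_) (*-inverseˡ δ)) (*-identityʳ d))

x<y⇒0<y-x : ∀ {x y} → x < y → 0ℚ < y - x
x<y⇒0<y-x {x} {y} x<y = subst (_< y - x) (+-inverseʳ x) (+-monoˡ-< (- x) x<y)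

module _ (x : ℝ) (δ : ℚ) .{{_ : Positive δ}} where

  walk : ∀ k {s} → s ∈ lower x → s + ⌜ k ⌝ * δ ∈ upper x →
         ∃[ s ] s ∈ lower x × s + δ + δ ∈ upper x
  walk zero {s} s∈ end = contradiction
    (lower<upper x s∈ (subst (upper x) (trans (cong (λ z → s + z) (*-zeroˡ δ)) (+-identityʳ s)) end))
    (<-irrefl refl)
  walk (suc k) {s} s∈ end with located x {s + δ} {s + δ + δ}
    (subst (_< s + δ + δ) (+-identityʳ (s + δ)) (+-monoʳ-< (s + δ) (positive⁻¹ δ)))
  ... | inj₁ s+δ∈ = walk k s+δ∈ (subst (upper x)
    (trans (cong (λ z → s + z * δ) (⌜suc⌝ k)) (step s δ ⌜ k ⌝)) end)
    where
    step : ∀ s d k → s + (1ℚ + k) * d ≡ s + d + k * d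
    step s d k = trans (cong (λ z → s + z) (trans (*-distribʳ-+ d 1ℚ k) (cong (_+ k * d) (*-identityˡ d))))
      (sym (+-assoc s d (k * d)))
  ... | inj₂ u∈ = s , s∈ , u∈

  grid : ∃[ s ] s ∈ lower x × s + δ + δ ∈ upper x
  grid with lower-inhabited x | upper-inhabited x
  ... | s , s∈ | u , u∈ with archimedean (u - s) δ
  ...   | k , u-s<kδ = walk k s∈ (upper-closed x
    (subst (_< s + ⌜ k ⌝ * δ) (rejoin s u) (+-monoʳ-< s u-s<kδ)) u∈)
    where
    rejoin : ∀ s u → s + (u - s) ≡ u
    rejoin = solve 2 (λ s u → s :+ (u :- s) := u) refl

halve : ∀ {ε} → 0ℚ < ε → ∃[ δ ] Positive δ × δ + δ < ε
halve {ε} 0<ε with <-dense 0<ε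
... | m , 0<m , m<ε = m * ½ , pos*pos⇒pos m {{positive 0<m}} ½ , subst (_< ε) (m≡ m) m<ε
  where
  m≡ : ∀ m → m ≡ m * ½ + m * ½
  m≡ m = trans (sym (*-identityʳ m)) (trans (cong (m *_) (sym ½+½≡1)) (*-distribˡ-+ m ½ ½))
    where
    ½+½≡1 : ½ + ½ ≡ 1ℚ
    ½+½≡1 = refl

abstract
  bracket : ∀ x {ε} → 0ℚ < ε → ∃[ s ] ∃[ u ] s ∈ lower x × u ∈ upper x × u - s < ε
  bracket x {ε} 0<ε = let δ , δ-pos , 2δ<ε = halve 0<ε in span δ 2δ<ε (grid x δ {{δ-pos}})
    where
    width : ∀ d s → d + d ≡ s + d + d - s
    width = solve 2 (λ d s → d :+ d := s :+ d :+ d :- s) refl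
    span : ∀ δ → δ + δ < ε → ∃[ s ] s ∈ lower x × s + δ + δ ∈ upper x →
           ∃[ s ] ∃[ u ] s ∈ lower x × u ∈ upper x × u - s < ε
    span δ 2δ<ε (s , s∈ , u∈) = s , s + δ + δ , s∈ , u∈ , subst (_< ε) (width δ s) 2δ<ε

infixl 6 _+ʳ_ _-ʳ_
infix  8 -ʳ_

-ʳ_ : ℝ → ℝ
-ʳ x = record
  { lower           = λ q → - q ∈ upper x
  ; upper           = λ q → - q ∈ lower x
  ; lower-inhabited = neg-inhabited (upper x) (upper-inhabited x)
  ; upper-inhabited = neg-inhabited (lower x) (lower-inhabited x)
  ; lower-closed    = λ p<q → upper-closed x (neg-antimono-< p<q)
  ; upper-closed    = λ p<q → lower-closed x (neg-antimono-< p<q)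
  ; lower-open      = λ {p} -p∈ → let r , r<-p , r∈ = upper-open x -p∈ in
      - r , subst (_< - r) (neg-involutive p) (neg-antimono-< r<-p)
          , subst (upper x) (sym (neg-involutive r)) r∈
  ; upper-open      = λ {q} -q∈ → let r , -q<r , r∈ = lower-open x -q∈ in
      - r , subst (- r <_) (neg-involutive q) (neg-antimono-< -q<r)
          , subst (lower x) (sym (neg-involutive r)) r∈
  ; lower<upper     = λ -p∈ -q∈ → neg-cancel-< (lower<upper x -q∈ -p∈)
  ; located         = λ p<q → swap (located x (neg-antimono-< p<q))
  }
  where
  neg-involutive : ∀ p → - - p ≡ p
  neg-involutive p = solve 1 (λ p → :- (:- p) := p) refl p
  neg-inhabited : (P : Pred ℚ 0ℓ) → Satisfiable P → Satisfiable (λ q → P (- q))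
  neg-inhabited P (p , p∈) = - p , subst P (sym (neg-involutive p)) p∈
  neg-cancel-< : ∀ {p q} → - q < - p → p < q
  neg-cancel-< {p} {q} lt = subst₂ _<_ (neg-involutive p) (neg-involutive q) (neg-antimono-< lt)

_+ʳ_ : ℝ → ℝ → ℝ
x +ʳ y = record
  { lower           = λ q → ∃[ s ] ∃[ t ] s ∈ lower x × t ∈ lower y × q ≡ s + t
  ; upper           = λ q → ∃[ s ] ∃[ t ] s ∈ upper x × t ∈ upper y × q ≡ s + t
  ; lower-inhabited = let s , s∈ = lower-inhabited x ; t , t∈ = lower-inhabited y in
      s + t , s , t , s∈ , t∈ , refl
  ; upper-inhabited = let s , s∈ = upper-inhabited x ; t , t∈ = upper-inhabited y in
      s + t , s , t , s∈ , t∈ , refl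
  ; lower-closed    = λ { {p} p<q (s , t , s∈ , t∈ , refl) →
      s , p - s , s∈ , lower-closed y (subst (p - s <_) (cancel s t) (+-monoˡ-< (- s) p<q)) t∈
        , split p s }
  ; upper-closed    = λ { {p} {q} p<q (s , t , s∈ , t∈ , refl) →
      s , q - s , s∈ , upper-closed y (subst (_< q - s) (cancel s t) (+-monoˡ-< (- s) p<q)) t∈
        , split q s }
  ; lower-open      = λ { (s , t , s∈ , t∈ , refl) → let t′ , t<t′ , t′∈ = lower-open y t∈ in
      s + t′ , +-monoʳ-< s t<t′ , s , t′ , s∈ , t′∈ , refl }
  ; upper-open      = λ { (s , t , s∈ , t∈ , refl) → let t′ , t′<t , t′∈ = upper-open y t∈ in
      s + t′ , +-monoʳ-< s t′<t , s , t′ , s∈ , t′∈ , refl }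
  ; lower<upper     = λ { (_ , _ , s∈ , t∈ , refl) (_ , _ , s′∈ , t′∈ , refl) →
      +-mono-< (lower<upper x s∈ s′∈) (lower<upper y t∈ t′∈) }
  ; located         = +-located
  }
  where
  cancel : ∀ s t → s + t - s ≡ t
  cancel s t = solve 2 (λ s t → s :+ t :- s := t) refl s t
  split : ∀ p s → p ≡ s + (p - s)
  split p s = solve 2 (λ p s → p := s :+ (p :- s)) refl p s
  +-located : ∀ {p q} → p < q →
    (∃[ s ] ∃[ t ] s ∈ lower x × t ∈ lower y × p ≡ s + t) ⊎
    (∃[ s ] ∃[ t ] s ∈ upper x × t ∈ upper y × q ≡ s + t)
  +-located {p} {q} p<q =
    let s , u , s∈ , u∈ , u-s<q-p = bracket x (x<y⇒0<y-x p<q) in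
    Sum.map
      (λ p-s∈ → s , p - s , s∈ , p-s∈ , split p s)
      (λ q-u∈ → u , q - u , u∈ , q-u∈ , split q u)
      (located y (subst₂ _<_ (left p s u) (right p q u) (+-monoˡ-< (p - u) u-s<q-p)))
    where
    left : ∀ p s u → u - s + (p - u) ≡ p - s
    left = solve 3 (λ p s u → u :- s :+ (p :- u) := p :- s) refl
    right : ∀ p q u → q - p + (p - u) ≡ q - u
    right = solve 3 (λ p q u → q :- p :+ (p :- u) := q :- u) refl

_-ʳ_ : ℝ → ℝ → ℝ
x -ʳ y = x +ʳ -ʳ y

------------------------------------------------------------------------
-- Computability: total functions generated from the initial functions by
-- composition, primitive recursion and minimisation of functions whose
-- least zero always exists.  Each schema is given by its defining
-- equations, so the class is closed under pointwise equality.

data Recursive : ∀ {k} → (Vec ℕ k → ℕ) → Set where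
  zeroᶠ : ∀ {k} {f : Vec ℕ k → ℕ} →
          (∀ xs → f xs ≡ 0) → Recursive f
  sucᶠ  : {f : Vec ℕ 1 → ℕ} →
          (∀ x → f (x ∷ []) ≡ suc x) → Recursive f
  projᶠ : ∀ {k} {f : Vec ℕ k → ℕ} (i : Fin k) →
          (∀ xs → f xs ≡ lookup xs i) → Recursive f
  compᶠ : ∀ {k l} {f : Vec ℕ k → ℕ} {g : Vec ℕ l → ℕ} {h : Fin l → Vec ℕ k → ℕ} →
          Recursive g → (∀ i → Recursive (h i)) →
          (∀ xs → f xs ≡ g (tabulate λ i → h i xs)) → Recursive f
  recᶠ  : ∀ {k} {f : Vec ℕ (suc k) → ℕ} {g : Vec ℕ k → ℕ} {h : Vec ℕ (suc (suc k)) → ℕ} →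
          Recursive g → Recursive h →
          (∀ xs → f (0 ∷ xs) ≡ g xs) →
          (∀ n xs → f (suc n ∷ xs) ≡ h (n ∷ f (n ∷ xs) ∷ xs)) → Recursive f
  minᶠ  : ∀ {k} {f : Vec ℕ k → ℕ} {g : Vec ℕ (suc k) → ℕ} →
          Recursive g →
          (∀ xs → g (f xs ∷ xs) ≡ 0) →
          (∀ xs y → y ℕ.< f xs → g (y ∷ xs) ≢ 0) → Recursive f

-- A {0,1}-valued function, or equivalently a decidable relation.
Recursiveᵇ : ∀ {k} → (Vec ℕ k → Bool) → Set
Recursiveᵇ f = Recursive λ xs → if f xs then 1 else 0

-- Subsets of ℚ are placed in the arithmetical hierarchy through the coding
-- of a rational by its sign and its numerator and denominator in lowest terms.
code : ℚ → Vec ℕ 3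
code q = sign (↥ q) ∷ ∣ ↥ q ∣ ∷ ↧ₙ q ∷ []
  where
  sign : ℤ → ℕ
  sign (+ _)    = 0
  sign -[1+ _ ] = 1

Π⁰₂ : Pred ℚ 0ℓ → Set
Π⁰₂ S = ∃[ R ] Recursiveᵇ R ×
  (∀ q → q ∈ S ⇔ (∀ x → ∃[ y ] R (x ∷ y ∷ code q) ≡ true))

LeftΠ⁰₂ : Pred ℝ 0ℓ
LeftΠ⁰₂ x = Π⁰₂ (lower x)

𝓓₂ : ℝ → Set₁
𝓓₂ r = ∃[ a ] ∃[ b ] LeftΠ⁰₂ a × LeftΠ⁰₂ b × r ≈ a -ʳ b

------------------------------------------------------------------------
-- Sets of natural numbers are identified with their characteristic
-- functions.  Under excluded middle these are all the subsets of ℕ;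
-- nothing is assumed about their computability.

Subsetℕ : Set
Subsetℕ = ℕ → Bool

∣_↾_∣ : Subsetℕ → ℕ → ℕ
∣ X ↾ m ∣ = length (filterᵇ X (upTo m))

ρ : (m : ℕ) .{{_ : ℕ.NonZero m}} → Subsetℕ → ℚ
ρ m X = + ∣ X ↾ m ∣ / m

-- ∣ρ m X − r∣ < ε is expressed as ρ m X − ε < r < ρ m X + ε.
HasDensity : Subsetℕ → ℝ → Set
HasDensity X r = ∀ ε → 0ℚ < ε → ∃[ M ] (∀ m .{{_ : ℕ.NonZero m}} → M ℕ.≤ m →
  ρ m X - ε ∈ lower r × ρ m X + ε ∈ upper r)

-- A possibly infinite set of naturals has at most n elements exactly when
-- each of its initial segments does.
AtMost : ℕ → Subsetℕ → Set
AtMost n X = ∀ m → ∣ X ↾ m ∣ ℕ.≤ n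

CE : ℕ → Subsetℕ → Set
CE n A = ∃[ g ] Recursiveᵇ {2} g × (∀ x →
  g (x ∷ 0 ∷ []) ≡ false ×
  (∃[ t ] (∀ s → t ℕ.≤ s → g (x ∷ s ∷ []) ≡ A x)) ×
  AtMost n (λ s → g (x ∷ s ∷ []) xor g (x ∷ suc s ∷ [])))

IsDensityOfCE : ℕ → Pred ℝ 0ℓ
IsDensityOfCE n r = ∃[ A ] CE n A × HasDensity A r

{-# OPTIONS --safe #-}

-- (⇒) Let U(m) and V(m) count all rises and all falls of an n-c.e. approximation g to A on the
-- arguments below m.  Both are limits of increasing computable approximations, both are at most n m,
-- and U(m) - V(m) is the number of elements of A below m.  As (U(m) - V(m))/m converges to r,
-- r = limsup U(m)/m - limsup V(m)/m, and the left cut of each limsup is Π⁰₂.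
--
-- (⇐) If r = 1, take A = ω.  If r = a - b < 1, some c satisfies c < b ≤ a < c + 1.  Let v be a
-- computable sequence equidistributed in [c, c + 1).  Enumerate x as soon as all of the first x
-- rationals q ≤ v x have passed the first x tests of the Π⁰₂ condition q < a.  This catches every x
-- with v x < a and, for each u > a, only finitely many x with v x ≥ u, because some rational q in
-- (a, u) fails a test.  The c.e. set K obtained from a minus the c.e. set L obtained from b is 2-c.e.
-- and has density a - b.

module Submission where

open import Level using (0ℓ)
open import Axiom.ExcludedMiddle using (ExcludedMiddle)
open import Data.Bool using (Bool; true; false; not; _∧_; _xor_; if_then_else_)
open import Data.Bool.Properties using (¬-not; ∧-zeroʳ)
open import Data.Fin using (Fin; zero; suc)
open import Data.Fin.Patterns
open import Data.List using ([]; _∷_; length; filterᵇ; upTo)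
open import Data.List.Properties using (length-++; filter-++; upTo-∷ʳ)
open import Data.Nat as ℕ using (ℕ; zero; suc)
open import Data.Product using (∃-syntax; _×_; _,_; proj₁; proj₂)
open import Data.Sum as Sum using (_⊎_; inj₁; inj₂)
open import Data.Vec using (Vec; []; _∷_; lookup; head; tail)
open import Data.Vec.Properties using (tabulate∘lookup)
open import Function using (_∘_; id)
open import Function.Bundles using (_⇔_; mk⇔; Equivalence)
open import Relation.Nullary using (¬_; Dec; yes; no; does; contradiction)
open import Relation.Nullary.Decidable using (T?)
open import Relation.Unary using (Pred; _∈_; _∉_)
open import Relation.Binary.Definitions using (tri<; tri≈; tri>)
open import Relation.Binary.PropositionalEquality
open import Defs

-- (⇒) Neither U(m)/m nor V(m)/m need converge, but their difference does, and adding a convergent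
-- sequence commutes with limsup. The condition for q to lie below limsup U(m)/m, that every M has
-- some m ≥ M and some stage with more than q m rises, is a ∀∃ condition on a computable test; it is
-- exact except possibly at one rational, which is treated separately. (⇐) The case r = 1 stands
-- apart because c < b and a < c + 1 force a - b < 1. On the block of arguments from s² to (s+1)² -
-- 1, v runs through c + j/(2s+1) for j ≤ 2s; the blocks below m number about √m and each costs a
-- bounded error, so the discrepancy is O(√m) and can be bounded by counting in ℕ. A Π⁰₂ condition
-- sees a rational only through its code in lowest terms, so the tests are run on a dense family of
-- rationals whose reduced form is explicit. Since b ≤ a, L lies in K up to a set of density zero,
-- and the densities subtract. Excluded middle locates the limsups, fixes the exceptional rational
-- and yields the characteristic functions of K and L.

module _ where

  open import Data.Nat
  open import Data.Nat.Properties
  open import Data.Nat.Solver using (module +-*-Solver)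

  -- Finite sums

  ∑ : ℕ → (ℕ → ℕ) → ℕ
  ∑ zero    f = 0
  ∑ (suc n) f = ∑ n f + f n

  syntax ∑ n (λ i → e) = ∑[ i < n ] e

  ∑-cong : ∀ n {f g} → (∀ i → i < n → f i ≡ g i) → ∑ n f ≡ ∑ n g
  ∑-cong zero    f≗g = refl
  ∑-cong (suc n) f≗g = cong₂ _+_ (∑-cong n (λ i i<n → f≗g i (m<n⇒m<1+n i<n))) (f≗g n ≤-refl)

  ∑-mono-≤ : ∀ n {f g} → (∀ i → f i ≤ g i) → ∑ n f ≤ ∑ n g
  ∑-mono-≤ zero    f≤g = z≤n
  ∑-mono-≤ (suc n) f≤g = +-mono-≤ (∑-mono-≤ n f≤g) (f≤g n)

  ∑-distrib-+ : ∀ n f g → ∑[ i < n ] (f i + g i) ≡ ∑ n f + ∑ n g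
  ∑-distrib-+ zero    f g = refl
  ∑-distrib-+ (suc n) f g = trans (cong (_+ (f n + g n)) (∑-distrib-+ n f g))
    (+-interchange (∑ n f) (∑ n g) (f n) (g n))
    where open import Algebra.Properties.CommutativeSemigroup +-commutativeSemigroup
            renaming (interchange to +-interchange)

  ∑-const : ∀ n c → ∑[ _ < n ] c ≡ n * c
  ∑-const zero    c = refl
  ∑-const (suc n) c = trans (cong (_+ c) (∑-const n c)) (+-comm (n * c) c)

  ∑-mono-range : ∀ {m n} f → m ≤ n → ∑ m f ≤ ∑ n f
  ∑-mono-range f m≤n = go f (≤⇒≤′ m≤n)
    where
    go : ∀ {m n} f → m ≤′ n → ∑ m f ≤ ∑ n f
    go f ≤′-refl       = ≤-refl
    go f (≤′-step m≤n) = ≤-trans (go f m≤n) (m≤m+n _ _)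

  term≤∑ : ∀ {n i} f → i < n → f i ≤ ∑ n f
  term≤∑ {i = i} f i<n = ≤-trans (m≤n+m (f i) (∑ i f)) (∑-mono-range f i<n)

  ∑>0⇒∃ : ∀ n f → 0 < ∑ n f → ∃[ i ] i < n × 0 < f i
  ∑>0⇒∃ (suc n) f 0<∑ with f n in eq
  ... | suc _ = n , ≤-refl , subst (0 <_) (sym eq) z<s
  ... | zero with ∑>0⇒∃ n f (subst (0 <_) (+-identityʳ _) 0<∑)
  ...   | i , i<n , 0<fi = i , m<n⇒m<1+n i<n , 0<fi

  Antitone : (ℕ → ℕ) → Set
  Antitone f = ∀ {s t} → s ≤ t → f t ≤ f s

  -- The maximum of the finitely many stages works for all terms at once, because a term that has
  -- reached zero stays zero.
  ∑-vanishes : ∀ n (f : ℕ → ℕ → ℕ) → (∀ i → Antitone (f i)) →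
    (∀ i → i < n → ∃[ s ] f i s ≡ 0) → ∃[ s ] ∑[ i < n ] f i s ≡ 0
  ∑-vanishes zero    f anti zeros = 0 , refl
  ∑-vanishes (suc n) f anti zeros
    with ∑-vanishes n f anti (λ i i<n → zeros i (m<n⇒m<1+n i<n)) | zeros n ≤-refl
  ... | s , ∑≡0 | t , fnt≡0 = s ⊔ t , n≤0⇒n≡0 (begin
    ∑[ i < n ] f i (s ⊔ t) + f n (s ⊔ t) ≤⟨ +-mono-≤
      (∑-mono-≤ n (λ i → anti i (m≤m⊔n s t))) (anti n (m≤n⊔m s t)) ⟩
    ∑[ i < n ] f i s + f n t             ≡⟨ cong₂ _+_ ∑≡0 fnt≡0 ⟩
    0                                    ∎)
    where open ≤-Reasoning

  -- Indicators

  𝟙 : Bool → ℕ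
  𝟙 b = if b then 1 else 0

  𝟙≤1 : ∀ b → 𝟙 b ≤ 1
  𝟙≤1 true  = ≤-refl
  𝟙≤1 false = z≤n

  ∣↾∣≡∑ : ∀ (X : Subsetℕ) m → ∣ X ↾ m ∣ ≡ ∑[ i < m ] 𝟙 (X i)
  ∣↾∣≡∑ X zero    = refl
  ∣↾∣≡∑ X (suc m) = trans (cong (length ∘ filterᵇ X) (sym (upTo-∷ʳ m)))
    (trans (cong length (filter-++ (T? ∘ X) (upTo m) (m ∷ [])))
    (trans (length-++ (filterᵇ X (upTo m)))
    (cong₂ _+_ (∣↾∣≡∑ X m) last)))
    where
    last : length (filterᵇ X (m ∷ [])) ≡ 𝟙 (X m)
    last with X m
    ... | true  = refl
    ... | false = refl

  ∑𝟙≤ : ∀ n (p : ℕ → Bool) → ∑[ i < n ] 𝟙 (p i) ≤ n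
  ∑𝟙≤ n p = ≤-trans (∑-mono-≤ n (𝟙≤1 ∘ p)) (≤-reflexive (trans (∑-const n 1) (*-identityʳ n)))

  isPos : ℕ → Bool
  isPos zero    = false
  isPos (suc _) = true

  isPos⁺ : ∀ {n} → 0 < n → isPos n ≡ true
  isPos⁺ {suc _} _ = refl

  isPos⁻ : ∀ {n} → isPos n ≡ true → 0 < n
  isPos⁻ {suc _} _ = z<s

  -- A truth value as a number: recursiveness follows from that of `_∸_`, and conjunction is
  -- multiplication.
  ⟦_≤_⟧ : ℕ → ℕ → ℕ
  ⟦ m ≤ n ⟧ = 1 ∸ (m ∸ n)

  ⟦≤⟧-true : ∀ {m n} → m ≤ n → ⟦ m ≤ n ⟧ ≡ 1
  ⟦≤⟧-true m≤n = cong (1 ∸_) (m≤n⇒m∸n≡0 m≤n)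

  ⟦≤⟧-false : ∀ {m n} → n < m → ⟦ m ≤ n ⟧ ≡ 0
  ⟦≤⟧-false n<m = m≤n⇒m∸n≡0 (m<n⇒0<n∸m n<m)

  ⟦≤⟧-sound : ∀ m n → 0 < ⟦ m ≤ n ⟧ → m ≤ n
  ⟦≤⟧-sound m n 0<[] with m ≤? n
  ... | yes m≤n = m≤n
  ... | no  m≰n = contradiction 0<[] (<-irrefl (sym (⟦≤⟧-false (≰⇒> m≰n))))

  *>0 : ∀ {m n} → 0 < m → 0 < n → 0 < m * n
  *>0 {suc _} {suc _} _ _ = z<s

  *>0⁻ : ∀ m n → 0 < m * n → 0 < m × 0 < n
  *>0⁻ (suc m) (suc n) _ = z<s , z<s
  *>0⁻ (suc m) zero 0<m*0 = contradiction (subst (0 <_) (*-zeroʳ m) 0<m*0) (<-irrefl refl)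

  -- Recursive functions

  -- Every schema is stated up to pointwise equality, so composing with the unary projection `head`
  -- transports recursiveness along one.
  ext : ∀ {k} {f g : Vec ℕ k → ℕ} → Recursive f → (∀ xs → g xs ≡ f xs) → Recursive g
  ext f-rec g≗f = compᶠ {l = 1} (projᶠ {f = head} 0F λ { (_ ∷ []) → refl }) (λ _ → f-rec) g≗f

  -- A record rather than a bare function type, so that unification can recover `hs` when argument
  -- lists are assembled with `_∷ᴿ_`.
  record Recursives {k l} (hs : Vec ℕ k → Vec ℕ l) : Set where
    field component : ∀ i → Recursive (λ xs → lookup (hs xs) i)

  open Recursives

  var : ∀ {k} (i : Fin k) → Recursive (λ xs → lookup xs i)
  var i = projᶠ i (λ _ → refl)

  []ᴿ : ∀ {k} → Recursives {k} (λ _ → [])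
  []ᴿ .component ()

  idᴿ : ∀ {k} → Recursives {k} id
  idᴿ .component = var

  infixr 5 _∷ᴿ_

  _∷ᴿ_ : ∀ {k l h} {hs : Vec ℕ k → Vec ℕ l} → Recursive h → Recursives hs →
         Recursives (λ xs → h xs ∷ hs xs)
  (h-rec ∷ᴿ hs-rec) .component zero    = h-rec
  (h-rec ∷ᴿ hs-rec) .component (suc i) = component hs-rec i

  comp : ∀ {k l} {g : Vec ℕ l → ℕ} {hs : Vec ℕ k → Vec ℕ l} →
         Recursive g → Recursives hs → Recursive (λ xs → g (hs xs))
  comp {g = g} {hs} g-rec hs-rec = compᶠ g-rec (component hs-rec)
    (λ xs → cong g (sym (tabulate∘lookup (hs xs))))

  constant : ∀ {k} c → Recursive {k} (λ _ → c)
  sucᴿ : ∀ {k} {f : Vec ℕ k → ℕ} → Recursive f → Recursive (λ xs → suc (f xs))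

  constant zero    = zeroᶠ (λ _ → refl)
  constant (suc c) = sucᴿ (constant c)

  sucᴿ f-rec = comp {g = suc ∘ head} (sucᶠ (λ _ → refl)) (f-rec ∷ᴿ []ᴿ)

  infixl 6 _+ᴿ_ _∸ᴿ_
  infixl 7 _*ᴿ_

  _+ᴿ_ : ∀ {k} {f g : Vec ℕ k → ℕ} → Recursive f → Recursive g → Recursive (λ xs → f xs + g xs)
  f-rec +ᴿ g-rec = comp +-recursive (f-rec ∷ᴿ g-rec ∷ᴿ []ᴿ)
    where
    +-recursive : Recursive {2} (λ xs → lookup xs 0F + lookup xs 1F)
    +-recursive = recᶠ (var 0F) (sucᴿ (var 1F)) (λ { (_ ∷ []) → refl }) (λ { n (_ ∷ []) → refl })

  _*ᴿ_ : ∀ {k} {f g : Vec ℕ k → ℕ} → Recursive f → Recursive g → Recursive (λ xs → f xs * g xs)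
  f-rec *ᴿ g-rec = comp *-recursive (f-rec ∷ᴿ g-rec ∷ᴿ []ᴿ)
    where
    *-recursive : Recursive {2} (λ xs → lookup xs 0F * lookup xs 1F)
    *-recursive = recᶠ (constant 0) (var 2F +ᴿ var 1F)
      (λ { (_ ∷ []) → refl }) (λ { n (_ ∷ []) → refl })

  _∸ᴿ_ : ∀ {k} {f g : Vec ℕ k → ℕ} → Recursive f → Recursive g → Recursive (λ xs → f xs ∸ g xs)
  -- Subtraction iterates the predecessor, so the recursion runs over the subtrahend, which has to
  -- come first.
  f-rec ∸ᴿ g-rec = comp ∸-recursive (g-rec ∷ᴿ f-rec ∷ᴿ []ᴿ)
    where
    pred-recursive : Recursive {1} (pred ∘ head)
    pred-recursive = recᶠ (constant 0) (var 0F) (λ { [] → refl }) (λ { n [] → refl })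
    ∸-recursive : Recursive {2} (λ xs → lookup xs 1F ∸ lookup xs 0F)
    ∸-recursive = recᶠ (var 0F) (comp pred-recursive (var 1F ∷ᴿ []ᴿ))
      (λ { (_ ∷ []) → refl }) (λ { n (m ∷ []) → sym (pred[m∸n]≡m∸[1+n] m n) })

  ⟦_≤_⟧ᴿ : ∀ {k} {f g : Vec ℕ k → ℕ} → Recursive f → Recursive g → Recursive (λ xs → ⟦ f xs ≤ g xs ⟧)
  ⟦ f-rec ≤ g-rec ⟧ᴿ = constant 1 ∸ᴿ (f-rec ∸ᴿ g-rec)

  𝟙∘isPosᴿ : ∀ {k} {f : Vec ℕ k → ℕ} → Recursive f → Recursive (λ xs → 𝟙 (isPos (f xs)))
  𝟙∘isPosᴿ {f = f} f-rec = ext (⟦ constant 1 ≤ f-rec ⟧ᴿ) (λ xs → eq (f xs))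
    where
    eq : ∀ n → 𝟙 (isPos n) ≡ ⟦ 1 ≤ n ⟧
    eq zero    = refl
    eq (suc n) = sym (⟦≤⟧-true {1} {suc n} (s≤s z≤n))

  ∑ᴿ : ∀ {k} {f : Vec ℕ (suc k) → ℕ} {b : Vec ℕ k → ℕ} → Recursive b → Recursive f →
       Recursive (λ xs → ∑[ i < b xs ] f (i ∷ xs))
  ∑ᴿ {k} {f} b-rec f-rec = comp loop (b-rec ∷ᴿ idᴿ)
    where
    -- The step function receives the counter, the partial sum and the parameters; the summand takes
    -- only the counter and the parameters.
    drop₂ : Recursives {suc (suc k)} (λ xs → tail (tail xs))
    drop₂ .component i = ext (var (suc (suc i))) (λ { (_ ∷ _ ∷ _) → refl })
    loop : Recursive {suc k} (λ xs → ∑[ i < head xs ] f (i ∷ tail xs))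
    loop = recᶠ (constant 0) (var 1F +ᴿ comp {hs = λ ys → head ys ∷ tail (tail ys)} f-rec
        (ext (var 0F) (λ { (_ ∷ _) → refl }) ∷ᴿ drop₂))
      (λ _ → refl) (λ _ _ → refl)

  -- Blocks [s², (s+1)²) swept at constant speed

  isqrt : ℕ → ℕ
  isqrt zero    = 0
  isqrt (suc x) = isqrt x + ⟦ suc (isqrt x) * suc (isqrt x) ≤ suc x ⟧

  blockLength offset : ℕ → ℕ
  blockLength x = suc (2 * isqrt x)
  offset x = x ∸ isqrt x * isqrt x

  isqrt-recursive : Recursive {1} λ xs → isqrt (lookup xs 0F)
  isqrt-recursive = recᶠ (constant 0)
    (var 1F +ᴿ ⟦ sucᴿ (var 1F) *ᴿ sucᴿ (var 1F) ≤ sucᴿ (var 0F) ⟧ᴿ)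
    (λ { [] → refl }) (λ { _ [] → refl })

  module _ {k} {f : Vec ℕ k → ℕ} (f-rec : Recursive f) where

    private
      sqrtᴿ : Recursive (λ xs → isqrt (f xs))
      sqrtᴿ = comp isqrt-recursive (f-rec ∷ᴿ []ᴿ)

    blockLengthᴿ : Recursive (λ xs → blockLength (f xs))
    blockLengthᴿ = sucᴿ (constant 2 *ᴿ sqrtᴿ)

    offsetᴿ : Recursive (λ xs → offset (f xs))
    offsetᴿ = f-rec ∸ᴿ sqrtᴿ *ᴿ sqrtᴿ

  private
    [1+s]² : ∀ s → suc s * suc s ≡ suc (2 * s) + s * s
    [1+s]² = solve 1 (λ s → (con 1 :+ s) :* (con 1 :+ s) := (con 1 :+ con 2 :* s) :+ s :* s) refl
      where open +-*-Solver

    record Position (x s : ℕ) : Set where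
      constructor position
      field
        {j}     : ℕ
        x≡      : x ≡ j + s * s
        j≤2s    : j ≤ 2 * s

    -- The remainder `j` carries the invariant s² ≤ x ≤ s² + 2s through the induction without
    -- truncated subtraction; it is identified with `offset x` afterwards.
    locate : ∀ x → Position x (isqrt x)
    locate zero = position refl z≤n
    locate (suc x) with locate x | suc (isqrt x) * suc (isqrt x) ≤? suc x
    ... | position {j} x≡ j≤2s | yes le
        rewrite ⟦≤⟧-true le | +-comm (isqrt x) 1 =
      position (≤-antisym (≤-trans (s≤s (≤-trans (≤-reflexive x≡) (+-monoˡ-≤ (isqrt x * isqrt x) j≤2s)))
        (≤-reflexive (sym ([1+s]² (isqrt x))))) le) z≤n
    ... | position {j} x≡ j≤2s | no ¬le
        rewrite ⟦≤⟧-false (≰⇒> ¬le) | +-identityʳ (isqrt x) =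
      position (cong suc x≡) (≤-pred (+-cancelʳ-≤ (isqrt x * isqrt x) _ _
        (subst₂ _≤_ (cong (λ z → suc (suc z)) x≡) ([1+s]² (isqrt x)) (≰⇒> ¬le))))

  isqrt²≤ : ∀ x → isqrt x * isqrt x ≤ x
  isqrt²≤ x with locate x
  ... | position {j} x≡ _ = ≤-trans (m≤n+m _ j) (≤-reflexive (sym x≡))

  offset+isqrt² : ∀ x → x ≡ offset x + isqrt x * isqrt x
  offset+isqrt² x = sym (m∸n+n≡m (isqrt²≤ x))

  offset<blockLength : ∀ x → offset x < blockLength x
  offset<blockLength x with locate x
  ... | position {j} x≡ j≤2s = s≤s (subst (_≤ 2 * isqrt x)
    (+-cancelʳ-≡ (isqrt x * isqrt x) j (offset x) (trans (sym x≡) (offset+isqrt² x))) j≤2s)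

  data NextBlock (x : ℕ) : Set where
    same : isqrt (suc x) ≡ isqrt x → offset (suc x) ≡ suc (offset x) → NextBlock x
    next : isqrt (suc x) ≡ suc (isqrt x) → offset (suc x) ≡ 0 → suc (offset x) ≡ blockLength x → NextBlock x

  nextBlock : ∀ x → NextBlock x
  nextBlock x with suc (isqrt x) * suc (isqrt x) ≤? suc x
  ... | no ¬le = same s≡ (+-cancelʳ-≡ (isqrt x * isqrt x) _ _ (begin
      offset (suc x) + isqrt x * isqrt x             ≡⟨ cong (λ s → offset (suc x) + s * s) s≡ ⟨
      offset (suc x) + isqrt (suc x) * isqrt (suc x) ≡⟨ offset+isqrt² (suc x) ⟨
      suc x                                          ≡⟨ cong suc (offset+isqrt² x) ⟩
      suc (offset x) + isqrt x * isqrt x             ∎))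
    where
    open ≡-Reasoning
    s≡ : isqrt (suc x) ≡ isqrt x
    s≡ = trans (cong (isqrt x +_) (⟦≤⟧-false (≰⇒> ¬le))) (+-identityʳ (isqrt x))
  ... | yes le = next s≡ (trans (cong (λ s → suc x ∸ s * s) s≡) (m≤n⇒m∸n≡0 (≤-reflexive x+1≡))) (
      +-cancelʳ-≡ (isqrt x * isqrt x) _ _ (trans (cong suc (sym (offset+isqrt² x)))
        (trans x+1≡ ([1+s]² (isqrt x)))))
    where
    s≡ : isqrt (suc x) ≡ suc (isqrt x)
    s≡ = trans (cong (isqrt x +_) (⟦≤⟧-true le)) (+-comm (isqrt x) 1)
    x+1≡ : suc x ≡ suc (isqrt x) * suc (isqrt x)
    x+1≡ = ≤-antisym (≤-trans (≤-trans (≤-reflexive (cong suc (offset+isqrt² x)))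
      (+-monoˡ-≤ (isqrt x * isqrt x) (offset<blockLength x))) (≤-reflexive (sym ([1+s]² (isqrt x))))) le

  -- The indicator of `offset x / blockLength x < P / Q`, with denominators cleared.
  below-ratio : ℕ → ℕ → ℕ → ℕ
  below-ratio P Q x = ⟦ suc (offset x * Q) ≤ P * blockLength x ⟧

  module Equidistribution (P Q : ℕ) (P≤Q : P ≤ Q) where

    private
      -- D is the number of points found when the sweep has covered j points of block s: up to one
      -- unit per block, Q D follows Q j until it saturates at P (2 s + 1).
      record Balanced (s j D : ℕ) : Set where
        constructor balanced
        field
          lower      : P * (s * s) + j * Q ≤ Q * D ⊎ P * (s * s) + P * suc (2 * s) ≤ Q * D
          upper      : Q * D ≤ P * (s * s) + s * Q + j * Q
          saturation : Q * D ≤ P * (s * s) + s * Q + (P * suc (2 * s) + Q)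

      assoc-suc : ∀ a j → a + j * Q + Q ≡ a + suc j * Q
      assoc-suc a j = trans (+-assoc a (j * Q) Q) (cong (a +_) (+-comm (j * Q) Q))

      Q*[D+1] : ∀ D → Q * (D + 1) ≡ Q * D + Q
      Q*[D+1] D = trans (*-distribˡ-+ Q D 1) (cong (Q * D +_) (*-identityʳ Q))

      -- While points are counted, j Q < P (2s+1), so the new `saturation` follows from the old
      -- `upper`. Once counting stops, D is frozen and j Q ≥ P (2s+1) turns the first alternative of
      -- `lower` into the second.
      advance : ∀ {s j D} → Balanced s j D → Balanced s (suc j) (D + ⟦ suc (j * Q) ≤ P * suc (2 * s) ⟧)
      advance {s} {j} {D} (balanced lower upper saturation) with suc (j * Q) ≤? P * suc (2 * s)
      ... | yes lt rewrite ⟦≤⟧-true lt = balanced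
        (Sum.map
          (λ le → subst₂ _≤_ (assoc-suc _ j) (sym (Q*[D+1] D)) (+-monoˡ-≤ Q le))
          (λ le → ≤-trans le (*-monoʳ-≤ Q (m≤m+n D 1))) lower)
        (subst₂ _≤_ (sym (Q*[D+1] D)) (assoc-suc _ j) (+-monoˡ-≤ Q upper))
        (subst₂ _≤_ (sym (Q*[D+1] D)) (+-assoc (P * (s * s) + s * Q) _ Q)
          (+-monoˡ-≤ Q (≤-trans upper (+-monoʳ-≤ (P * (s * s) + s * Q) (<⇒≤ lt)))))
      ... | no ¬lt rewrite ⟦≤⟧-false (≰⇒> ¬lt) | +-identityʳ D = balanced
        (inj₂ (Sum.[ ≤-trans (+-monoʳ-≤ (P * (s * s)) (≤-pred (≰⇒> ¬lt))) , (λ le → le) ] lower))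
        (≤-trans upper (+-monoʳ-≤ (P * (s * s) + s * Q) (m≤n+m (j * Q) Q)))
        saturation

      P[1+s]² : ∀ s → P * (s * s) + P * suc (2 * s) ≡ P * (suc s * suc s)
      P[1+s]² s = trans (sym (*-distribˡ-+ P (s * s) (suc (2 * s))))
        (cong (P *_) (trans (+-comm (s * s) (suc (2 * s))) (sym ([1+s]² s))))

      -- The term P (2s+1) completes P s² to P (s+1)², and the extra Q of `saturation` becomes the
      -- error unit of the finished block.
      wrap : ∀ {s D} → Balanced s (suc (2 * s)) D → Balanced (suc s) 0 D
      wrap {s} {D} (balanced lower upper saturation) = balanced
        (inj₁ (≤-trans (≤-reflexive (trans (+-identityʳ _) (sym (P[1+s]² s))))
          (Sum.[ ≤-trans (+-monoʳ-≤ (P * (s * s)) (≤-trans (*-monoˡ-≤ (suc (2 * s)) P≤Q)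
              (≤-reflexive (*-comm Q (suc (2 * s)))))) , (λ le → le) ] lower)))
        (≤-trans upper′ (m≤m+n _ 0))
        (≤-trans upper′ (m≤m+n _ _))
        where
        upper′ : Q * D ≤ P * (suc s * suc s) + suc s * Q
        upper′ = subst (Q * D ≤_) (trans (rearrange (P * (s * s)) (s * Q) (P * suc (2 * s)) Q)
          (cong (_+ suc s * Q) (P[1+s]² s))) saturation
          where
          open +-*-Solver
          rearrange : ∀ a b c d → a + b + (c + d) ≡ a + c + (d + b)
          rearrange = solve 4 (λ a b c d → a :+ b :+ (c :+ d) := a :+ c :+ (d :+ b)) refl

      balance : ∀ x → Balanced (isqrt x) (offset x) (∑ x (below-ratio P Q))
      balance zero = balanced
        (inj₁ (≤-reflexive (trans (+-identityʳ (P * 0)) (trans (*-zeroʳ P) (sym (*-zeroʳ Q))))))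
        (subst (_≤ P * 0 + 0 + 0) (sym (*-zeroʳ Q)) z≤n)
        (subst (_≤ P * 0 + 0 + (P * 1 + Q)) (sym (*-zeroʳ Q)) z≤n)
      balance (suc x) with nextBlock x
      ... | same s≡ j≡ = subst₂ (λ s j → Balanced s j (∑ (suc x) (below-ratio P Q))) (sym s≡) (sym j≡)
        (advance (balance x))
      ... | next s≡ j≡ full = subst₂ (λ s j → Balanced s j (∑ (suc x) (below-ratio P Q))) (sym s≡) (sym j≡)
        (wrap (subst (λ j → Balanced (isqrt x) j (∑ (suc x) (below-ratio P Q))) full (advance (balance x))))

    -- There is no error on this side: a block starts with its smallest fractions, so the count
    -- always runs ahead of the proportion P/Q.
    count-lower : ∀ m → P * m ≤ Q * ∑ m (below-ratio P Q)
    count-lower m = ≤-trans (≤-reflexive P*m≡) (go (Balanced.lower (balance m)))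
      where
      s = isqrt m
      P*m≡ : P * m ≡ P * (s * s) + P * offset m
      P*m≡ = trans (cong (P *_) (trans (offset+isqrt² m) (+-comm (offset m) (s * s))))
        (*-distribˡ-+ P (s * s) (offset m))
      go : P * (s * s) + offset m * Q ≤ Q * ∑ m (below-ratio P Q) ⊎ P * (s * s) + P * suc (2 * s) ≤ Q * ∑ m (below-ratio P Q) →
           P * (s * s) + P * offset m ≤ Q * ∑ m (below-ratio P Q)
      go (inj₁ le) = ≤-trans (+-monoʳ-≤ (P * (s * s))
        (≤-trans (*-monoˡ-≤ (offset m) P≤Q) (≤-reflexive (*-comm Q (offset m))))) le
      go (inj₂ le) = ≤-trans (+-monoʳ-≤ (P * (s * s)) (*-monoʳ-≤ P (<⇒≤ (offset<blockLength m)))) le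

    -- With s = `isqrt m`, the finished blocks contribute s units Q of error; the current one is
    -- charged P (2s+1) + Q, at most 2s + 2 further units. This is the origin of 3s + 2.
    count-upper : ∀ m → Q * ∑ m (below-ratio P Q) ≤ P * m + Q * (3 * isqrt m + 2)
    count-upper m = begin
      Q * ∑ m (below-ratio P Q)                     ≤⟨ Balanced.saturation (balance m) ⟩
      P * (s * s) + s * Q + (P * suc (2 * s) + Q)   ≤⟨ +-mono-≤ (+-monoˡ-≤ (s * Q) (*-monoʳ-≤ P (isqrt²≤ m)))
                                                       (+-monoˡ-≤ Q (*-monoˡ-≤ (suc (2 * s)) P≤Q)) ⟩
      P * m + s * Q + (Q * suc (2 * s) + Q)         ≡⟨ rearrange (P * m) s Q ⟩
      P * m + Q * (3 * s + 2)                       ∎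
      where
      open ≤-Reasoning
      s = isqrt m
      rearrange : ∀ a s Q → a + s * Q + (Q * suc (2 * s) + Q) ≡ a + Q * (3 * s + 2)
      rearrange = solve 3 (λ a s Q → a :+ s :* Q :+ (Q :* (con 1 :+ con 2 :* s) :+ Q)
        := a :+ Q :* (con 3 :* s :+ con 2)) refl
        where open +-*-Solver

open import Data.Integer as ℤ using (_⊖_; -[1+_])
import Data.Integer.Properties as ℤ
open import Data.Nat.Coprimality using (Coprime)
open import Data.Nat.Divisibility using (_∣_; ∣1⇒≡1; ∣m+n∣m⇒∣n; ∣m∣n⇒∣m+n; ∣n⇒∣m*n; ∣m⇒∣m*n)
import Data.Nat.Properties as ℕ
import Data.Nat.Solver as ℕ
open import Data.Rational hiding (∣_∣)
open import Data.Rational.Properties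
open import Data.Rational.Solver using (module +-*-Solver)
import Data.Rational.Unnormalised as ℚᵘ
import Data.Rational.Unnormalised.Properties as ℚᵘ

open Equivalence using (to; from)
open ℝ

-- Rationals

⌜⌝-homo-+ : ∀ m n → ⌜ m ℕ.+ n ⌝ ≡ ⌜ m ⌝ + ⌜ n ⌝
⌜⌝-homo-+ m n = toℚᵘ-injective (ℚᵘ.≃-trans
  (ℚᵘ.*≡* (cong (ℤ._* ℤ.+ 1) (trans (ℤ.pos-+ m n)
    (cong₂ ℤ._+_ (sym (ℤ.*-identityʳ (ℤ.+ m))) (sym (ℤ.*-identityʳ (ℤ.+ n)))))))
  (ℚᵘ.≃-sym (toℚᵘ-homo-+ ⌜ m ⌝ ⌜ n ⌝)))

⌜⌝-homo-* : ∀ m n → ⌜ m ℕ.* n ⌝ ≡ ⌜ m ⌝ * ⌜ n ⌝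
⌜⌝-homo-* m n = toℚᵘ-injective (ℚᵘ.≃-trans
  (ℚᵘ.*≡* (cong (ℤ._* ℤ.+ 1) (ℤ.pos-* m n)))
  (ℚᵘ.≃-sym (toℚᵘ-homo-* ⌜ m ⌝ ⌜ n ⌝)))

⌜⌝-mono-≤ : ∀ {m n} → m ℕ.≤ n → ⌜ m ⌝ ≤ ⌜ n ⌝
⌜⌝-mono-≤ m≤n = *≤* (ℤ.*-monoʳ-≤-nonNeg (ℤ.+ 1) (ℤ.+≤+ m≤n))

⌜⌝-mono-< : ∀ {m n} → m ℕ.< n → ⌜ m ⌝ < ⌜ n ⌝
⌜⌝-mono-< m<n = *<* (ℤ.*-monoʳ-<-pos (ℤ.+ 1) (ℤ.+<+ m<n))

⌜⌝-cancel-< : ∀ {m n} → ⌜ m ⌝ < ⌜ n ⌝ → m ℕ.< n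
⌜⌝-cancel-< {m} {n} (*<* lt) = ℤ.drop‿+<+ (ℤ.*-cancelʳ-<-nonNeg (ℤ.+ 1) lt)

⌜⌝-cancel-≤ : ∀ {m n} → ⌜ m ⌝ ≤ ⌜ n ⌝ → m ℕ.≤ n
⌜⌝-cancel-≤ m≤n = ℕ.≮⇒≥ λ n<m → <-irrefl refl (<-≤-trans (⌜⌝-mono-< n<m) m≤n)

/-*-cancel : ∀ u w .{{_ : ℕ.NonZero w}} → ℤ.+ u / w * ⌜ w ⌝ ≡ ⌜ u ⌝
/-*-cancel u w@(suc w-1) = toℚᵘ-injective (ℚᵘ.≃-trans (toℚᵘ-homo-* (ℤ.+ u / w) ⌜ w ⌝)
  (ℚᵘ.≃-trans (ℚᵘ.*-cong (toℚᵘ-fromℚᵘ (ℚᵘ.mkℚᵘ (ℤ.+ u) w-1)) (ℚᵘ.≃-refl {toℚᵘ ⌜ w ⌝}))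
  (ℚᵘ.*≡* (trans (ℤ.*-identityʳ _) (sym (cong (ℤ.+ u ℤ.*_) (cong ℤ.+_ (ℕ.*-identityʳ w))))))))

↥≡*↧ : ∀ u d .(c : Coprime u (suc d)) → mkℚ (ℤ.+ u) d c * ⌜ suc d ⌝ ≡ ⌜ u ⌝
↥≡*↧ u d c = trans (cong (_* ⌜ suc d ⌝) (sym (↥p/↧p≡p (mkℚ (ℤ.+ u) d c)))) (/-*-cancel u (suc d))

instance
  ⌜suc⌝-positive : ∀ {n} → Positive ⌜ suc n ⌝
  ⌜suc⌝-positive = positive (⌜⌝-mono-< ℕ.z<s)

  ⌜⌝-nonNegative : ∀ {n} → NonNegative ⌜ n ⌝
  ⌜⌝-nonNegative {n} = nonNegative (⌜⌝-mono-≤ {n = n} ℕ.z≤n)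

+-cancelʳ-<ℚ : ∀ r {p q} → p + r < q + r → p < q
+-cancelʳ-<ℚ r {p} {q} lt = subst₂ _<_ (eq p r) (eq q r) (+-monoˡ-< (- r) lt)
  where
  open +-*-Solver
  eq : ∀ p r → p + r - r ≡ p
  eq = solve 2 (λ p r → p :+ r :- r := p) refl

<⌜⌝⇔< : ∀ q a b D .{{_ : ℕ.NonZero D}} → q * ⌜ D ⌝ + ⌜ b ⌝ ≡ ⌜ a ⌝ →
  ∀ m n → q * ⌜ m ⌝ < ⌜ n ⌝ ⇔ a ℕ.* m ℕ.< n ℕ.* D ℕ.+ b ℕ.* m
<⌜⌝⇔< q a b D@(suc _) qD+b≡a m n = mk⇔
  (λ lt → ⌜⌝-cancel-< (subst₂ _<_ lhs rhs (+-monoˡ-< (⌜ b ⌝ * ⌜ m ⌝) (*-monoˡ-<-pos ⌜ D ⌝ lt))))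
  (λ lt → *-cancelʳ-<-nonNeg ⌜ D ⌝ (+-cancelʳ-<ℚ (⌜ b ⌝ * ⌜ m ⌝)
    (subst₂ _<_ (sym lhs) (sym rhs) (⌜⌝-mono-< lt))))
  where
  open +-*-Solver
  lhs : q * ⌜ m ⌝ * ⌜ D ⌝ + ⌜ b ⌝ * ⌜ m ⌝ ≡ ⌜ a ℕ.* m ⌝
  lhs = trans (eq q ⌜ m ⌝ ⌜ D ⌝ ⌜ b ⌝)
    (trans (cong (_* ⌜ m ⌝) qD+b≡a) (sym (⌜⌝-homo-* a m)))
    where
    eq : ∀ q m D b → q * m * D + b * m ≡ (q * D + b) * m
    eq = solve 4 (λ q m D b → q :* m :* D :+ b :* m := (q :* D :+ b) :* m) refl
  rhs : ⌜ n ⌝ * ⌜ D ⌝ + ⌜ b ⌝ * ⌜ m ⌝ ≡ ⌜ n ℕ.* D ℕ.+ b ℕ.* m ⌝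
  rhs = sym (trans (⌜⌝-homo-+ (n ℕ.* D) (b ℕ.* m)) (cong₂ _+_ (⌜⌝-homo-* n D) (⌜⌝-homo-* b m)))

-- The entries of code q are s, u, d with q = (1 - 2s) u / d; separating the two signs keeps the
-- comparison q m < n within ℕ.
code-<⌜⌝ : Vec ℕ 3 → ℕ → ℕ → Set
code-<⌜⌝ (s ∷ u ∷ d ∷ []) m n = (1 ℕ.∸ s) ℕ.* u ℕ.* m ℕ.< n ℕ.* d ℕ.+ s ℕ.* u ℕ.* m

<⌜⌝⇔code : ∀ q m n → q * ⌜ m ⌝ < ⌜ n ⌝ ⇔ code-<⌜⌝ (code q) m n
<⌜⌝⇔code q@(mkℚ (ℤ.+ u) d c) = <⌜⌝⇔< q (1 ℕ.* u) 0 (suc d) (trans (+-identityʳ _)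
  (trans (↥≡*↧ u d c) (cong ⌜_⌝ (sym (ℕ.+-identityʳ u)))))
<⌜⌝⇔code q@(mkℚ -[1+ u ] d c) = <⌜⌝⇔< q 0 (1 ℕ.* suc u) (suc d) (trans
  (cong₂ _+_ (trans (sym (neg-distribˡ-* (mkℚ (ℤ.+ suc u) d c) ⌜ suc d ⌝)) (cong -_ (↥≡*↧ (suc u) d c)))
    (cong ⌜_⌝ (ℕ.+-identityʳ (suc u))))
  (+-inverseˡ ⌜ suc u ⌝))

code-injective : ∀ {p q} → code p ≡ code q → p ≡ q
code-injective {mkℚ (ℤ.+ _)    _ _} {mkℚ (ℤ.+ _)    _ _} refl = refl
code-injective {mkℚ -[1+ _ ] _ _} {mkℚ -[1+ _ ] _ _} refl = refl

-- Dedekind reals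

lower-closed-≤ : ∀ x {p q} → p ≤ q → q ∈ lower x → p ∈ lower x
lower-closed-≤ x p≤q q∈ = let r , q<r , r∈ = lower-open x q∈ in lower-closed x (≤-<-trans p≤q q<r) r∈

upper-closed-≤ : ∀ x {p q} → p ≤ q → p ∈ upper x → q ∈ upper x
upper-closed-≤ x p≤q p∈ = let r , r<p , r∈ = upper-open x p∈ in upper-closed x (<-≤-trans r<p p≤q) r∈

-- Located cuts are maximal: for q < r with r below x, locatedness of y puts q below y or r above y,
-- and the latter would put r on both sides of x.
≈-from-⊆ : ∀ {x y} → (∀ q → q ∈ lower y → q ∈ lower x) → (∀ q → q ∈ upper y → q ∈ upper x) → x ≈ y
≈-from-⊆ {x} {y} lower⊆ upper⊆ =
  (λ q → mk⇔ (λ q∈ → let r , q<r , r∈ = lower-open x q∈ in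
    case-lower r∈ (located y q<r)) (lower⊆ q)) ,
  (λ q → mk⇔ (λ q∈ → let p , p<q , p∈ = upper-open x q∈ in
    case-upper p∈ (located y p<q)) (upper⊆ q))
  where
  case-lower : ∀ {q r} → r ∈ lower x → q ∈ lower y ⊎ r ∈ upper y → q ∈ lower y
  case-lower r∈ (inj₁ q∈) = q∈
  case-lower r∈ (inj₂ r∈′) = contradiction (lower<upper x r∈ (upper⊆ _ r∈′)) (<-irrefl refl)
  case-upper : ∀ {p q} → p ∈ upper x → p ∈ lower y ⊎ q ∈ upper y → q ∈ upper y
  case-upper p∈ (inj₁ p∈′) = contradiction (lower<upper x (lower⊆ _ p∈′) p∈) (<-irrefl refl)
  case-upper p∈ (inj₂ q∈) = q∈

distance : ℕ → ℕ → ℕ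
distance m n = (m ℕ.∸ n) ℕ.+ (n ℕ.∸ m)

distance-refl : ∀ n → distance n n ≡ 0
distance-refl n = cong₂ ℕ._+_ (ℕ.n∸n≡0 n) (ℕ.n∸n≡0 n)

distance≡0⇒≡ : ∀ m n → distance m n ≡ 0 → m ≡ n
distance≡0⇒≡ m n d≡0 = ℕ.≤-antisym (ℕ.m∸n≡0⇒m≤n (ℕ.m+n≡0⇒m≡0 _ d≡0))
  (ℕ.m∸n≡0⇒m≤n (ℕ.m+n≡0⇒n≡0 (m ℕ.∸ n) d≡0))

-- Positive exactly when the codes differ, so that inequality of codes can enter a recursive test as
-- a factor.
distance₃ : Vec ℕ 3 → Vec ℕ 3 → ℕ
distance₃ (s ∷ u ∷ d ∷ []) (s′ ∷ u′ ∷ d′ ∷ []) = distance s s′ ℕ.+ distance u u′ ℕ.+ distance d d′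

distance₃>0⇒≢ : ∀ v w → 0 ℕ.< distance₃ v w → v ≢ w
distance₃>0⇒≢ (s ∷ u ∷ d ∷ []) _ 0<d refl = contradiction
  (subst (0 ℕ.<_) (cong₂ ℕ._+_ (cong₂ ℕ._+_ (distance-refl s) (distance-refl u)) (distance-refl d)) 0<d)
  ℕ.n≮0

≢⇒distance₃>0 : ∀ v w → v ≢ w → 0 ℕ.< distance₃ v w
≢⇒distance₃>0 v@(s ∷ u ∷ d ∷ []) w@(s′ ∷ u′ ∷ d′ ∷ []) v≢w = ℕ.n≢0⇒n>0 λ eq →
  let eq′ = ℕ.m+n≡0⇒m≡0 _ eq in
  v≢w (cong₂ _∷_ (distance≡0⇒≡ s s′ (ℕ.m+n≡0⇒m≡0 _ eq′))
    (cong₂ _∷_ (distance≡0⇒≡ u u′ (ℕ.m+n≡0⇒n≡0 (distance s s′) eq′))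
    (cong (_∷ []) (distance≡0⇒≡ d d′ (ℕ.m+n≡0⇒n≡0 (distance s s′ ℕ.+ distance u u′) eq)))))

-- The limit superior of sup_s c m s / m

module Limsup (em : ExcludedMiddle 0ℓ) (c : ℕ → ℕ → ℕ) (b : ℕ) (c-bounded : ∀ m s → c m s ℕ.≤ b ℕ.* m) where

  Above Below : Pred ℚ 0ℓ
  Above q = ∀ M → ∃[ m ] M ℕ.≤ m × ∃[ s ] q * ⌜ m ⌝ < ⌜ c m s ⌝
  Below q = ∃[ M ] (∀ m → M ℕ.≤ m → ∀ s → ⌜ c m s ⌝ ≤ q * ⌜ m ⌝)

  above⊎below : ∀ q → Above q ⊎ Below q
  above⊎below q with em {Below q}
  ... | yes below = inj₂ below
  ... | no ¬below = inj₁ λ M → cofinal M em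
    where
    cofinal : ∀ M → Dec (∃[ m ] M ℕ.≤ m × ∃[ s ] q * ⌜ m ⌝ < ⌜ c m s ⌝) →
              ∃[ m ] M ℕ.≤ m × ∃[ s ] q * ⌜ m ⌝ < ⌜ c m s ⌝
    cofinal M (yes p) = p
    cofinal M (no ¬p) = contradiction
      (M , λ m M≤m s → ≮⇒≥ λ lt → ¬p (m , M≤m , s , lt)) ¬below

  above-below⇒< : ∀ {p q} → Above p → Below q → p < q
  above-below⇒< above (M , below) = let m , M≤m , s , lt = above M in
    *-cancelʳ-<-nonNeg ⌜ m ⌝ (<-≤-trans lt (below m M≤m s))

  above-antitone : ∀ {p q} → p ≤ q → Above q → Above p
  above-antitone p≤q above M = let m , M≤m , s , lt = above M in
    m , M≤m , s , ≤-<-trans (*-monoʳ-≤-nonNeg ⌜ m ⌝ p≤q) lt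

  -- `Above q` may hold when q is itself the limit superior; asking for it at some larger rational
  -- makes the lower cut open, and dually for the upper cut.
  limsup : ℝ
  limsup = record
    { lower           = λ q → ∃[ r ] q < r × Above r
    ; upper           = λ q → ∃[ r ] r < q × Below r
    -- `suc M` instead of M, because at m = 0 both sides of the strict inequality vanish.
    ; lower-inhabited = - 1ℚ - 1ℚ , - 1ℚ , decide-< , λ M → suc M , ℕ.n≤1+n M , 0 ,
        <-≤-trans (subst (- 1ℚ * ⌜ suc M ⌝ <_) (*-zeroˡ ⌜ suc M ⌝) (*-monoˡ-<-pos ⌜ suc M ⌝ -1<0))
          (nonNegative⁻¹ ⌜ c (suc M) 0 ⌝)
    ; upper-inhabited = ⌜ suc b ⌝ , ⌜ b ⌝ , ⌜⌝-mono-< (ℕ.n<1+n b) , 0 , λ m _ s →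
        subst (⌜ c m s ⌝ ≤_) (⌜⌝-homo-* b m) (⌜⌝-mono-≤ (c-bounded m s))
    ; lower-closed    = λ { p<q (r , q<r , above) → r , <-trans p<q q<r , above }
    ; upper-closed    = λ { p<q (r , r<p , below) → r , <-trans r<p p<q , below }
    ; lower-open      = λ { (r , q<r , above) → let s , q<s , s<r = <-dense q<r in
        s , q<s , r , s<r , above }
    ; upper-open      = λ { (r , r<q , below) → let s , r<s , s<q = <-dense r<q in
        s , s<q , r , r<s , below }
    ; lower<upper     = λ { (r , p<r , above) (s , s<q , below) →
        <-trans p<r (<-trans (above-below⇒< above below) s<q) }
    ; located         = λ p<q → let r , p<r , r<q = <-dense p<q in
        Sum.map (λ above → r , p<r , above) (λ below → r , r<q , below) (above⊎below r)
    }
    where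
    -1<0 : - 1ℚ < 0ℚ
    -1<0 = neg-antimono-< (positive⁻¹ 1ℚ)
    decide-< : - 1ℚ - 1ℚ < - 1ℚ
    decide-< = subst (- 1ℚ - 1ℚ <_) (+-identityʳ (- 1ℚ)) (+-monoʳ-< (- 1ℚ) -1<0)

  Boundary : Pred ℚ 0ℓ
  Boundary q = q ∉ lower limsup × q ∉ upper limsup

  -- Above q and q < limsup differ at most when limsup is the rational q; excluding its code
  -- (or, if limsup is irrational, an unattained code) turns the former into the latter.
  module _ (c-mono : ∀ m {s t} → s ℕ.≤ t → c m s ℕ.≤ c m t)
           (c-recursive : Recursive {2} λ xs → c (lookup xs 0F) (lookup xs 1F)) where

    private
      boundaryCode : Dec (∃[ q ] q ∈ Boundary) → Vec ℕ 3
      boundaryCode (yes (q , _)) = code q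
      -- The last entry of a code is a denominator, hence positive.
      boundaryCode (no _)        = 0 ∷ 0 ∷ 0 ∷ []

      lower⇒code≢ : ∀ d {q} → q ∈ lower limsup → code q ≢ boundaryCode d
      lower⇒code≢ (yes (p , p∉ , _)) q∈ eq = p∉ (subst (lower limsup) (code-injective eq) q∈)
      lower⇒code≢ (no _)             q∈ ()

      boundary-unique : ∀ {p q} → p ∈ Boundary → q ∈ Boundary → p ≡ q
      boundary-unique {p} {q} (p∉l , p∉u) (q∉l , q∉u) with <-cmp p q
      ... | tri≈ _ p≡q _ = p≡q
      ... | tri< p<q _ _ with located limsup p<q
      ...   | inj₁ p∈ = contradiction p∈ p∉l
      ...   | inj₂ q∈ = contradiction q∈ q∉u
      boundary-unique {p} {q} (p∉l , p∉u) (q∉l , q∉u) | tri> _ _ q<p with located limsup q<p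
      ...   | inj₁ q∈ = contradiction q∈ q∉l
      ...   | inj₂ p∈ = contradiction p∈ p∉u

      boundary⇒code≡ : ∀ d {q} → q ∈ Boundary → code q ≡ boundaryCode d
      boundary⇒code≡ (yes (p , p∈)) q∈ = cong code (boundary-unique q∈ p∈)
      boundary⇒code≡ (no ¬p)        q∈ = contradiction (_ , q∈) ¬p

      lower⇔above : ∀ d q → q ∈ lower limsup ⇔ (Above q × code q ≢ boundaryCode d)
      lower⇔above d q = mk⇔
        (λ { q∈@(r , q<r , above) → above-antitone (<⇒≤ q<r) above , lower⇒code≢ d q∈ })
        (λ { (above , code≢) → by-cases above code≢ em em })
        where
        by-cases : Above q → code q ≢ boundaryCode d → Dec (q ∈ lower limsup) → Dec (q ∈ upper limsup) →
                   q ∈ lower limsup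
        by-cases above code≢ (yes q∈) _ = q∈
        by-cases above code≢ (no q∉l) (yes (r , r<q , below)) =
          contradiction (<-trans (above-below⇒< above below) r<q) (<-irrefl refl)
        by-cases above code≢ (no q∉l) (no q∉u) = contradiction (boundary⇒code≡ d (q∉l , q∉u)) code≢

      test : ℕ → ℕ → ℕ → ℕ → ℕ → ℕ
      test m y s u d = ⟦ suc ((1 ℕ.∸ s) ℕ.* u ℕ.* m) ≤ c m y ℕ.* d ℕ.+ s ℕ.* u ℕ.* m ⟧

      -- A single bound y serves both the argument m and the stage. By monotonicity in the stage, a
      -- success at m and stage t is still seen at y = `suc m ⊔ t`.
      hits : ℕ → ℕ → ℕ → ℕ → ℕ → ℕ
      hits M y s u d = ∑[ m < y ] (⟦ M ≤ m ⟧ ℕ.* test m y s u d)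

      module _ (e : Vec ℕ 3) where

        witness : Vec ℕ 5 → ℕ
        witness (M ∷ y ∷ s ∷ u ∷ d ∷ []) = hits M y s u d ℕ.* distance₃ (s ∷ u ∷ d ∷ []) e

        witness-recursive : Recursive witness
        witness-recursive = ext
          (∑ᴿ (var 1F) (⟦ var 1F ≤ var 0F ⟧ᴿ *ᴿ
            ⟦ sucᴿ ((constant 1 ∸ᴿ var 3F) *ᴿ var 4F *ᴿ var 0F)
            ≤ comp c-recursive (var 0F ∷ᴿ var 2F ∷ᴿ []ᴿ) *ᴿ var 5F +ᴿ var 3F *ᴿ var 4F *ᴿ var 0F ⟧ᴿ)
           *ᴿ (dist (var 2F) 0F +ᴿ dist (var 3F) 1F +ᴿ dist (var 4F) 2F))
          (λ { (M ∷ y ∷ s ∷ u ∷ d ∷ []) → lemma M y s u d e })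
          where
          dist : ∀ {k} {f : Vec ℕ k → ℕ} → Recursive f → ∀ i → Recursive (λ xs → distance (f xs) (lookup e i))
          dist f-rec i = (f-rec ∸ᴿ constant (lookup e i)) +ᴿ (constant (lookup e i) ∸ᴿ f-rec)
          lemma : ∀ M y s u d e → hits M y s u d ℕ.* distance₃ (s ∷ u ∷ d ∷ []) e ≡
            hits M y s u d ℕ.* (distance s (lookup e 0F) ℕ.+ distance u (lookup e 1F) ℕ.+ distance d (lookup e 2F))
          lemma M y s u d (_ ∷ _ ∷ _ ∷ []) = refl

        witness⁺ : ∀ q v → (∀ m n → q * ⌜ m ⌝ < ⌜ n ⌝ ⇔ code-<⌜⌝ v m n) →
          Above q → v ≢ e → ∀ M → ∃[ y ] 0 ℕ.< witness (M ∷ y ∷ v)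
        witness⁺ q (s ∷ u ∷ d ∷ []) <⇔ above v≢e M = let m , M≤m , t , lt = above M ; y = suc m ℕ.⊔ t in
          y , *>0
            (ℕ.<-≤-trans (*>0 (ℕ.≤-reflexive (sym (⟦≤⟧-true M≤m)))
              (ℕ.≤-reflexive (sym (⟦≤⟧-true (to (<⇔ m (c m y))
                (<-≤-trans lt (⌜⌝-mono-≤ (c-mono m (ℕ.m≤n⊔m (suc m) t)))))))))
              (term≤∑ (λ m → ⟦ M ≤ m ⟧ ℕ.* test m y s u d) (ℕ.m≤m⊔n (suc m) t)))
            (≢⇒distance₃>0 (s ∷ u ∷ d ∷ []) e v≢e)

        witness⁻ : ∀ q v → (∀ m n → q * ⌜ m ⌝ < ⌜ n ⌝ ⇔ code-<⌜⌝ v m n) →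
          (∀ M → ∃[ y ] 0 ℕ.< witness (M ∷ y ∷ v)) → Above q × v ≢ e
        witness⁻ q v@(s ∷ u ∷ d ∷ []) <⇔ wit =
          (λ M → let y , 0<w = wit M
                     m , _ , 0<term = ∑>0⇒∃ y _ (proj₁ (*>0⁻ (hits M y s u d) _ 0<w))
                     0<M≤m , 0<test = *>0⁻ ⟦ M ≤ m ⟧ _ 0<term in
            m , ⟦≤⟧-sound M m 0<M≤m , y , from (<⇔ m (c m y)) (⟦≤⟧-sound _ _ 0<test)) ,
          (let y , 0<w = wit 0 in distance₃>0⇒≢ v e (proj₂ (*>0⁻ (hits 0 y s u d) _ 0<w)))

    -- The exceptional code is chosen by excluded middle, but it enters the test only as a constant,
    -- so the test is recursive.
    limsup-leftΠ⁰₂ : LeftΠ⁰₂ limsup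
    limsup-leftΠ⁰₂ = isPos ∘ witness e , 𝟙∘isPosᴿ (witness-recursive e) , λ q → mk⇔
      (λ q∈ M → let above , code≢ = to (lower⇔above em q) q∈
                    y , 0<w = witness⁺ e q (code q) (<⌜⌝⇔code q) above code≢ M in y , isPos⁺ 0<w)
      (λ wit → from (lower⇔above em q) (witness⁻ e q (code q) (<⌜⌝⇔code q) (λ M → let y , w = wit M in y , isPos⁻ w)))
      where e = boundaryCode em

-- Rises and falls of a single approximation

m∸n+n≡n∸m+m : ∀ m n → m ℕ.∸ n ℕ.+ n ≡ n ℕ.∸ m ℕ.+ m
m∸n+n≡n∸m+m m n with ℕ.≤-total m n
... | inj₁ m≤n = trans (cong (ℕ._+ n) (ℕ.m≤n⇒m∸n≡0 m≤n)) (sym (ℕ.m∸n+n≡m m≤n))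
... | inj₂ n≤m = trans (ℕ.m∸n+n≡m n≤m) (sym (cong (ℕ._+ m) (ℕ.m≤n⇒m∸n≡0 n≤m)))

module Variation (γ : ℕ → ℕ) where

  rise fall : ℕ → ℕ
  rise s = γ (suc s) ℕ.∸ γ s
  fall s = γ s ℕ.∸ γ (suc s)

  -- Telescoping from γ 0 = 0, with the falls moved to the other side to stay in ℕ.
  rises≡falls+ : γ 0 ≡ 0 → ∀ s → ∑ s rise ≡ ∑ s fall ℕ.+ γ s
  rises≡falls+ γ0≡0 zero    = sym γ0≡0
  rises≡falls+ γ0≡0 (suc s) = begin
    ∑ s rise ℕ.+ rise s                ≡⟨ cong (ℕ._+ rise s) (rises≡falls+ γ0≡0 s) ⟩
    ∑ s fall ℕ.+ γ s ℕ.+ rise s        ≡⟨ ℕ.+-assoc (∑ s fall) (γ s) (rise s) ⟩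
    ∑ s fall ℕ.+ (γ s ℕ.+ rise s)      ≡⟨ cong (∑ s fall ℕ.+_) (trans (ℕ.+-comm (γ s) (rise s))
                                            (m∸n+n≡n∸m+m (γ (suc s)) (γ s))) ⟩
    ∑ s fall ℕ.+ (fall s ℕ.+ γ (suc s)) ≡⟨ ℕ.+-assoc (∑ s fall) (fall s) (γ (suc s)) ⟨
    ∑ (suc s) fall ℕ.+ γ (suc s)        ∎
    where open ≡-Reasoning

eventually-constant-below : ∀ {A : Set} (f : ℕ → ℕ → A) (lim : ℕ → A) →
  (∀ x → ∃[ t ] (∀ s → t ℕ.≤ s → f x s ≡ lim x)) →
  ∀ m → ∃[ t ] (∀ s → t ℕ.≤ s → ∀ x → x ℕ.< m → f x s ≡ lim x)
eventually-constant-below f lim limit zero = 0 , λ _ _ _ ()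
eventually-constant-below f lim limit (suc m)
  with eventually-constant-below f lim limit m | limit m
... | t , before | u , at = t ℕ.⊔ u , λ s t⊔u≤s x x<1+m → go s t⊔u≤s x (ℕ.m<1+n⇒m<n∨m≡n x<1+m)
  where
  go : ∀ s → t ℕ.⊔ u ℕ.≤ s → ∀ x → x ℕ.< m ⊎ x ≡ m → f x s ≡ lim x
  go s t⊔u≤s x (inj₁ x<m)  = before s (ℕ.≤-trans (ℕ.m≤m⊔n t u) t⊔u≤s) x x<m
  go s t⊔u≤s x (inj₂ refl) = at s (ℕ.≤-trans (ℕ.m≤n⊔m t u) t⊔u≤s)

ρ-*-cancel : ∀ m .{{_ : ℕ.NonZero m}} X → ρ m X * ⌜ m ⌝ ≡ ⌜ ∣ X ↾ m ∣ ⌝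
ρ-*-cancel m X = /-*-cancel ∣ X ↾ m ∣ m

0≤ρ : ∀ m .{{_ : ℕ.NonZero m}} X → 0ℚ ≤ ρ m X
0≤ρ m@(suc _) X = *-cancelʳ-≤-pos ⌜ m ⌝
  (subst₂ _≤_ (sym (*-zeroˡ ⌜ m ⌝)) (sym (ρ-*-cancel m X)) (⌜⌝-mono-≤ {n = ∣ X ↾ m ∣} ℕ.z≤n))

ρ≤1 : ∀ m .{{_ : ℕ.NonZero m}} X → ρ m X ≤ 1ℚ
ρ≤1 m@(suc _) X = *-cancelʳ-≤-pos ⌜ m ⌝
  (subst₂ _≤_ (sym (ρ-*-cancel m X)) (sym (*-identityˡ ⌜ m ⌝))
    (⌜⌝-mono-≤ (subst (ℕ._≤ m) (sym (∣↾∣≡∑ X m)) (∑𝟙≤ m X))))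

-- Were 0 above r, some p < 0 would be too; with ε = - p the density condition gives ρ + p < p,
-- against ρ ≥ 0. The bound at 1 is symmetric.
density∈[0,1] : ∀ {X r} → HasDensity X r → r ∈[0,1]
density∈[0,1] {X} {r} density = 0∉upper , 1∉lower
  where
  0∉upper : 0ℚ ∉ upper r
  0∉upper 0∈ = let p , p<0 , p∈ = upper-open r 0∈
                   M , bounds = density (- p) (neg-antimono-< p<0)
                   ρ+p∈ , _ = bounds (suc M) (ℕ.n≤1+n M) in
    <-irrefl refl (<-≤-trans (lower<upper r ρ+p∈ p∈)
      (subst (_≤ ρ (suc M) X - - p) (eq p) (+-monoˡ-≤ (- - p) (0≤ρ (suc M) X))))
    where
    open +-*-Solver
    eq : ∀ p → 0ℚ - - p ≡ p
    eq = solve 1 (λ p → con 0ℚ :- :- p := p) refl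
  1∉lower : 1ℚ ∉ lower r
  1∉lower 1∈ = let q , 1<q , q∈ = lower-open r 1∈
                   M , bounds = density (q - 1ℚ) (x<y⇒0<y-x 1<q)
                   _ , ρ+q-1∈ = bounds (suc M) (ℕ.n≤1+n M) in
    <-irrefl refl (<-≤-trans (lower<upper r q∈ ρ+q-1∈)
      (subst (ρ (suc M) X + (q - 1ℚ) ≤_) (eq q) (+-monoˡ-≤ (q - 1ℚ) (ρ≤1 (suc M) X))))
    where
    open +-*-Solver
    eq : ∀ q → 1ℚ + (q - 1ℚ) ≡ q
    eq = solve 1 (λ q → con 1ℚ :+ (q :- con 1ℚ) := q) refl

-- From an n-c.e. set to a difference of left-Π⁰₂ reals

module FromCE (em : ExcludedMiddle 0ℓ) (n : ℕ) (A : Subsetℕ) (A-ce : CE n A)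
              (r : ℝ) (density : HasDensity A r) where

  private
    g = proj₁ A-ce

    γ : ℕ → ℕ → ℕ
    γ x s = 𝟙 (g (x ∷ s ∷ []))

    open module Changes x = Variation (γ x)

    rises falls : ℕ → ℕ → ℕ
    rises m s = ∑[ x < m ] ∑ s (rise x)
    falls m s = ∑[ x < m ] ∑ s (fall x)

    changes≤n : ∀ x s → ∑[ t < s ] 𝟙 (g (x ∷ t ∷ []) xor g (x ∷ suc t ∷ [])) ℕ.≤ n
    changes≤n x s = subst (ℕ._≤ n) (∣↾∣≡∑ _ s) (proj₂ (proj₂ (proj₂ (proj₂ A-ce) x)) s)

    rise≤change : ∀ a b → 𝟙 b ℕ.∸ 𝟙 a ℕ.≤ 𝟙 (a xor b)
    rise≤change true  true  = ℕ.z≤n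
    rise≤change true  false = ℕ.z≤n
    rise≤change false true  = ℕ.≤-refl
    rise≤change false false = ℕ.z≤n

    fall≤change : ∀ a b → 𝟙 a ℕ.∸ 𝟙 b ℕ.≤ 𝟙 (a xor b)
    fall≤change true  true  = ℕ.z≤n
    fall≤change true  false = ℕ.≤-refl
    fall≤change false true  = ℕ.z≤n
    fall≤change false false = ℕ.z≤n

    ∑≤n*m : (f : ℕ → ℕ → ℕ) → (∀ x t → f x t ℕ.≤ 𝟙 (g (x ∷ t ∷ []) xor g (x ∷ suc t ∷ []))) →
      ∀ m s → ∑[ x < m ] ∑ s (f x) ℕ.≤ n ℕ.* m
    ∑≤n*m f f≤ m s = ℕ.≤-trans (∑-mono-≤ m (λ x → ℕ.≤-trans (∑-mono-≤ s (f≤ x)) (changes≤n x s)))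
      (ℕ.≤-reflexive (trans (∑-const m n) (ℕ.*-comm m n)))

    rises≤ : ∀ m s → rises m s ℕ.≤ n ℕ.* m
    rises≤ = ∑≤n*m rise (λ x t → rise≤change (g (x ∷ t ∷ [])) (g (x ∷ suc t ∷ [])))

    falls≤ : ∀ m s → falls m s ℕ.≤ n ℕ.* m
    falls≤ = ∑≤n*m fall (λ x t → fall≤change (g (x ∷ t ∷ [])) (g (x ∷ suc t ∷ [])))

    rises-mono : ∀ m {s t} → s ℕ.≤ t → rises m s ℕ.≤ rises m t
    rises-mono m s≤t = ∑-mono-≤ m (λ x → ∑-mono-range (rise x) s≤t)

    falls-mono : ∀ m {s t} → s ℕ.≤ t → falls m s ℕ.≤ falls m t
    falls-mono m s≤t = ∑-mono-≤ m (λ x → ∑-mono-range (fall x) s≤t)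

    rises-recursive : Recursive {2} λ xs → rises (lookup xs 0F) (lookup xs 1F)
    rises-recursive = ∑ᴿ {f = λ xs → ∑ (lookup xs 2F) (rise (lookup xs 0F))} (var 0F)
      (∑ᴿ {f = λ xs → rise (lookup xs 1F) (lookup xs 0F)} (var 2F)
        (comp (proj₁ (proj₂ A-ce)) (var 1F ∷ᴿ sucᴿ (var 0F) ∷ᴿ []ᴿ) ∸ᴿ
         comp (proj₁ (proj₂ A-ce)) (var 1F ∷ᴿ var 0F ∷ᴿ []ᴿ)))

    falls-recursive : Recursive {2} λ xs → falls (lookup xs 0F) (lookup xs 1F)
    falls-recursive = ∑ᴿ {f = λ xs → ∑ (lookup xs 2F) (fall (lookup xs 0F))} (var 0F)
      (∑ᴿ {f = λ xs → fall (lookup xs 1F) (lookup xs 0F)} (var 2F)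
        (comp (proj₁ (proj₂ A-ce)) (var 1F ∷ᴿ var 0F ∷ᴿ []ᴿ) ∸ᴿ
         comp (proj₁ (proj₂ A-ce)) (var 1F ∷ᴿ sucᴿ (var 0F) ∷ᴿ []ᴿ)))

    module U = Limsup em rises n rises≤
    module V = Limsup em falls n falls≤

    α = U.limsup
    β = V.limsup

    -- The difference of rises and falls is the cardinality only after all arguments below m have
    -- settled; the freedom to take t beyond a given s lets bounds found at stage s be carried over
    -- by monotonicity.
    settled : ∀ m s → ∃[ t ] s ℕ.≤ t × rises m t ≡ falls m t ℕ.+ ∣ A ↾ m ∣
    settled m s with eventually-constant-below (λ x s → g (x ∷ s ∷ [])) A
                       (λ x → proj₁ (proj₂ (proj₂ (proj₂ A-ce) x))) m
    ... | t , constant-from = s ℕ.⊔ t , ℕ.m≤m⊔n s t , (begin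
      rises m u                                    ≡⟨ ∑-cong m (λ x _ → rises≡falls+ x
                                                       (cong 𝟙 (proj₁ (proj₂ (proj₂ A-ce) x))) u) ⟩
      ∑[ x < m ] (∑ u (fall x) ℕ.+ γ x u)          ≡⟨ ∑-distrib-+ m (λ x → ∑ u (fall x)) (λ x → γ x u) ⟩
      falls m u ℕ.+ ∑[ x < m ] γ x u               ≡⟨ cong (falls m u ℕ.+_) (∑-cong m
                                                       (λ x x<m → cong 𝟙 (constant-from u (ℕ.m≤n⊔m s t) x x<m))) ⟩
      falls m u ℕ.+ ∑[ x < m ] 𝟙 (A x)             ≡⟨ cong (falls m u ℕ.+_) (∣↾∣≡∑ A m) ⟨
      falls m u ℕ.+ ∣ A ↾ m ∣                      ∎)
      where
      open ≡-Reasoning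
      u = s ℕ.⊔ t

    ⌜rises⌝ : ∀ m .{{_ : ℕ.NonZero m}} t → rises m t ≡ falls m t ℕ.+ ∣ A ↾ m ∣ →
      ⌜ rises m t ⌝ ≡ ⌜ falls m t ⌝ + ρ m A * ⌜ m ⌝
    ⌜rises⌝ m t eq = trans (cong ⌜_⌝ eq) (trans (⌜⌝-homo-+ (falls m t) ∣ A ↾ m ∣)
      (cong (λ z → ⌜ falls m t ⌝ + z) (sym (ρ-*-cancel m A))))

    -- At a settled stage, a m < rises = falls + ρ m ≤ (b + ρ) m. The bound on falls holds at all
    -- stages for large m, while the first inequality holds for unboundedly many m; `suc M` keeps m
    -- positive.
    ρ> : ∀ {a b} → U.Above a → V.Below b → ∀ M → ∃[ m ] suc M ℕ.≤ suc m × a < b + ρ (suc m) A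
    ρ> {a} {b} above (N , below) M = let m , M≤m , s , lt = above (suc M ℕ.⊔ N) in
      go m (ℕ.≤-trans (ℕ.m≤m⊔n (suc M) N) M≤m) (ℕ.≤-trans (ℕ.m≤n⊔m (suc M) N) M≤m) s lt
      where
      go : ∀ m → suc M ℕ.≤ m → N ℕ.≤ m → ∀ s → a * ⌜ m ⌝ < ⌜ rises m s ⌝ →
        ∃[ m ] suc M ℕ.≤ suc m × a < b + ρ (suc m) A
      go m′@(suc m) M<m N≤m s lt with settled m′ s
      ... | t , s≤t , eq = m , M<m , *-cancelʳ-<-nonNeg ⌜ m′ ⌝ (begin-strict
        a * ⌜ m′ ⌝                          <⟨ lt ⟩
        ⌜ rises m′ s ⌝                      ≤⟨ ⌜⌝-mono-≤ (rises-mono m′ s≤t) ⟩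
        ⌜ rises m′ t ⌝                      ≡⟨ ⌜rises⌝ m′ t eq ⟩
        ⌜ falls m′ t ⌝ + ρ m′ A * ⌜ m′ ⌝    ≤⟨ +-monoˡ-≤ (ρ m′ A * ⌜ m′ ⌝) (below m′ N≤m t) ⟩
        b * ⌜ m′ ⌝ + ρ m′ A * ⌜ m′ ⌝        ≡⟨ *-distribʳ-+ ⌜ m′ ⌝ b (ρ m′ A) ⟨
        (b + ρ m′ A) * ⌜ m′ ⌝               ∎)
        where open ≤-Reasoning

    ρ< : ∀ {a b} → U.Below a → V.Above b → ∀ M → ∃[ m ] suc M ℕ.≤ suc m × b + ρ (suc m) A < a
    ρ< {a} {b} (N , below) above M = let m , M≤m , s , lt = above (suc M ℕ.⊔ N) in
      go m (ℕ.≤-trans (ℕ.m≤m⊔n (suc M) N) M≤m) (ℕ.≤-trans (ℕ.m≤n⊔m (suc M) N) M≤m) s lt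
      where
      go : ∀ m → suc M ℕ.≤ m → N ℕ.≤ m → ∀ s → b * ⌜ m ⌝ < ⌜ falls m s ⌝ →
        ∃[ m ] suc M ℕ.≤ suc m × b + ρ (suc m) A < a
      go m′@(suc m) M<m N≤m s lt with settled m′ s
      ... | t , s≤t , eq = m , M<m , *-cancelʳ-<-nonNeg ⌜ m′ ⌝ (begin-strict
        (b + ρ m′ A) * ⌜ m′ ⌝               ≡⟨ *-distribʳ-+ ⌜ m′ ⌝ b (ρ m′ A) ⟩
        b * ⌜ m′ ⌝ + ρ m′ A * ⌜ m′ ⌝        <⟨ +-monoˡ-< (ρ m′ A * ⌜ m′ ⌝)
                                                (<-≤-trans lt (⌜⌝-mono-≤ (falls-mono m′ s≤t))) ⟩
        ⌜ falls m′ t ⌝ + ρ m′ A * ⌜ m′ ⌝    ≡⟨ ⌜rises⌝ m′ t eq ⟨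
        ⌜ rises m′ t ⌝                      ≤⟨ below m′ N≤m t ⟩
        a * ⌜ m′ ⌝                          ∎)
        where open ≤-Reasoning

    lower⊆ : ∀ q → q ∈ lower (α -ʳ β) → q ∈ lower r
    lower⊆ q (s , t , (s′ , s<s′ , above) , (w , w<-t , below) , q≡s+t) =
      -- This ε is the excess of `s′ - w` over q. Once ρ > `s′ - w`, the rational ρ - ε still
      -- exceeds q, and the density condition puts it below r.
      let M , bounds = density (s′ - w - q) (x<y⇒0<y-x q<s′-w)
          m , M≤m , lt = ρ> {s′} {w} above below M
          ρ-ε∈ , _ = bounds (suc m) (ℕ.≤-trans (ℕ.n≤1+n M) M≤m) in
      lower-closed r (subst₂ _<_ (eq₁ s′ w q) (eq₂ s′ w q (ρ (suc m) A))
        (+-monoˡ-< (q - s′) lt)) ρ-ε∈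
      where
      open +-*-Solver
      eq₁ : ∀ s w q → s + (q - s) ≡ q
      eq₁ = solve 3 (λ s w q → s :+ (q :- s) := q) refl
      eq₂ : ∀ s w q p → w + p + (q - s) ≡ p - (s - w - q)
      eq₂ = solve 4 (λ s w q p → w :+ p :+ (q :- s) := p :- (s :- w :- q)) refl
      eq₃ : ∀ s t → s - - t ≡ s + t
      eq₃ = solve 2 (λ s t → s :- :- t := s :+ t) refl
      q<s′-w : q < s′ - w
      q<s′-w = subst (_< s′ - w) (trans (eq₃ s t) (sym q≡s+t)) (+-mono-< s<s′ (neg-antimono-< w<-t))

    upper⊆ : ∀ q → q ∈ upper (α -ʳ β) → q ∈ upper r
    upper⊆ q (s , t , (s′ , s′<s , below) , (w , -t<w , above) , q≡s+t) =
      let M , bounds = density (q - (s′ - w)) (x<y⇒0<y-x s′-w<q)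
          m , M≤m , lt = ρ< {s′} {w} below above M
          _ , ρ+ε∈ = bounds (suc m) (ℕ.≤-trans (ℕ.n≤1+n M) M≤m) in
      upper-closed r (subst₂ _<_ (eq₂ s′ w q (ρ (suc m) A)) (eq₁ s′ w q)
        (+-monoˡ-< (q - s′) lt)) ρ+ε∈
      where
      open +-*-Solver
      eq₁ : ∀ s w q → s + (q - s) ≡ q
      eq₁ = solve 3 (λ s w q → s :+ (q :- s) := q) refl
      eq₂ : ∀ s w q p → w + p + (q - s) ≡ p + (q - (s - w))
      eq₂ = solve 4 (λ s w q p → w :+ p :+ (q :- s) := p :+ (q :- (s :- w))) refl
      eq₃ : ∀ s t → s - - t ≡ s + t
      eq₃ = solve 2 (λ s t → s :- :- t := s :+ t) refl
      s′-w<q : s′ - w < q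
      s′-w<q = subst (s′ - w <_) (trans (eq₃ s t) (sym q≡s+t)) (+-mono-< s′<s (neg-antimono-< -t<w))

  density∈𝓓₂ : 𝓓₂ r
  density∈𝓓₂ = α , β , U.limsup-leftΠ⁰₂ rises-mono rises-recursive ,
    V.limsup-leftΠ⁰₂ falls-mono falls-recursive , ≈-from-⊆ {r} {α -ʳ β} lower⊆ upper⊆

-- Quotients of naturals, not necessarily in lowest terms

infix 4 _≐_/_

-- Keeping only the equation with the denominator cleared reduces comparison and addition to ℕ
-- without any normalisation.
record _≐_/_ (p : ℚ) (u w : ℕ) : Set where
  constructor fraction
  field cleared : p * ⌜ w ⌝ ≡ ⌜ u ⌝

module _ {p p′ u u′ w w′} (p≐ : p ≐ u / suc w) (p′≐ : p′ ≐ u′ / suc w′) where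

  private
    W = ⌜ suc w ⌝
    W′ = ⌜ suc w′ ⌝
    eq : p * W * W′ ≡ ⌜ u ℕ.* suc w′ ⌝
    eq = trans (cong (_* W′) (_≐_/_.cleared p≐)) (sym (⌜⌝-homo-* u (suc w′)))
    eq′ : p′ * W * W′ ≡ ⌜ u′ ℕ.* suc w ⌝
    eq′ = trans (swap p′ W W′) (trans (cong (_* W) (_≐_/_.cleared p′≐)) (sym (⌜⌝-homo-* u′ (suc w))))
      where
      open +-*-Solver
      swap : ∀ a b c → a * b * c ≡ a * c * b
      swap = solve 3 (λ a b c → a :* b :* c := a :* c :* b) refl

  ≐-< : u ℕ.* suc w′ ℕ.< u′ ℕ.* suc w → p < p′
  ≐-< lt = *-cancelʳ-<-nonNeg W (*-cancelʳ-<-nonNeg W′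
    (subst₂ _<_ (sym eq) (sym eq′) (⌜⌝-mono-< lt)))

  ≐-≤ : u ℕ.* suc w′ ℕ.≤ u′ ℕ.* suc w → p ≤ p′
  ≐-≤ le = *-cancelʳ-≤-pos W (*-cancelʳ-≤-pos W′
    (subst₂ _≤_ (sym eq) (sym eq′) (⌜⌝-mono-≤ le)))

  ≐-<⁻ : p < p′ → u ℕ.* suc w′ ℕ.< u′ ℕ.* suc w
  ≐-<⁻ p<p′ = ⌜⌝-cancel-< (subst₂ _<_ eq eq′ (*-monoˡ-<-pos W′ (*-monoˡ-<-pos W p<p′)))

  ≐-≤⁻ : p ≤ p′ → u ℕ.* suc w′ ℕ.≤ u′ ℕ.* suc w
  ≐-≤⁻ p≤p′ = ⌜⌝-cancel-≤ (subst₂ _≤_ eq eq′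
    (*-monoʳ-≤-nonNeg W′ (*-monoʳ-≤-nonNeg W p≤p′)))

nonNegative-≐ : ∀ {p} → 0ℚ ≤ p → ∃[ u ] ∃[ w ] p ≐ u / suc w
nonNegative-≐ {mkℚ (ℤ.+ u) d c} _ = u , d , fraction (↥≡*↧ u d c)
nonNegative-≐ {mkℚ -[1+ u ] d c} (*≤* ())

/-≐ : ∀ u w → ℤ.+ u / suc w ≐ u / suc w
/-≐ u w = fraction (/-*-cancel u (suc w))

-- Since N² divides k²N² = (kN + 1) (kN - 1) + 1, the fraction (kN + 1)/N² - B is in lowest terms,
-- so that its code is computed without division.

gridNumerator : ℕ → ℕ → ℕ
gridNumerator k N = suc (k ℕ.* suc N)

-- `mkℚ` stores the predecessor of the denominator; in this form its successor is definitionally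
-- `suc N * suc N`.
gridDenominator-1 : ℕ → ℕ
gridDenominator-1 N = N ℕ.+ N ℕ.* suc N

∣⊖∣≡distance : ∀ u v → ℤ.∣ u ⊖ v ∣ ≡ distance u v
∣⊖∣≡distance u v with ℕ.≤-total u v
... | inj₁ u≤v = trans (ℤ.∣⊖∣-≤ u≤v) (sym (cong (ℕ._+ (v ℕ.∸ u)) (ℕ.m≤n⇒m∸n≡0 u≤v)))
... | inj₂ v≤u = trans (ℤ.∣m⊖n∣≡∣n⊖m∣ u v) (trans (ℤ.∣⊖∣-≤ v≤u)
  (trans (sym (ℕ.+-identityʳ _)) (sym (cong (u ℕ.∸ v ℕ.+_) (ℕ.m≤n⇒m∸n≡0 v≤u)))))

∣∣u⊖v∣⇒∣u : ∀ {d} u v → d ∣ v → d ∣ ℤ.∣ u ⊖ v ∣ → d ∣ u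
∣∣u⊖v∣⇒∣u {d} u v d∣v d∣u⊖v with ℕ.≤-total u v
... | inj₁ u≤v = ∣m+n∣m⇒∣n (subst (d ∣_) (sym (ℕ.m∸n+n≡m u≤v)) d∣v) (subst (d ∣_) (ℤ.∣⊖∣-≤ u≤v) d∣u⊖v)
... | inj₂ v≤u = subst (d ∣_) (ℕ.m∸n+n≡m v≤u)
  (∣m∣n⇒∣m+n (subst (d ∣_) (trans (ℤ.∣m⊖n∣≡∣n⊖m∣ u v) (ℤ.∣⊖∣-≤ v≤u)) d∣u⊖v) d∣v)

grid-coprime : ∀ B k N → Coprime ℤ.∣ gridNumerator k N ⊖ B ℕ.* suc (gridDenominator-1 N) ∣ (suc (gridDenominator-1 N))
grid-coprime B k N {d} (d∣num , d∣N²) = ∣1⇒≡1 (∣m+n∣m⇒∣n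
  (subst (d ∣_) (ℕ.+-comm 1 (k ℕ.* suc N)) d∣u)
  (∣m+n∣m⇒∣n (subst (d ∣_) (square k (suc N)) (∣m⇒∣m*n (k ℕ.* suc N) d∣u)) (∣n⇒∣m*n (k ℕ.* k) d∣N²)))
  where
  d∣u : d ∣ gridNumerator k N
  d∣u = ∣∣u⊖v∣⇒∣u (gridNumerator k N) (B ℕ.* suc (gridDenominator-1 N)) (∣n⇒∣m*n B d∣N²) d∣num
  square : ∀ k N → suc (k ℕ.* N) ℕ.* (k ℕ.* N) ≡ k ℕ.* k ℕ.* (N ℕ.* N) ℕ.+ k ℕ.* N
  square = solve 2 (λ k N → (con 1 :+ k :* N) :* (k :* N) := k :* k :* (N :* N) :+ k :* N) refl
    where open ℕ.+-*-Solver

-- The shift by `B` makes every rational above `- ⌜ B ⌝` approachable while the parameters k and N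
-- remain natural numbers.
gridPoint : ℕ → ℕ → ℕ → ℚ
gridPoint B k N = mkℚ (gridNumerator k N ⊖ B ℕ.* suc (gridDenominator-1 N)) (gridDenominator-1 N) (grid-coprime B k N)

-- The numerator is a variable `i` with an equation, so that matching can replace it by its signed
-- normal form although the coprimality proof depends on it.
code-⊖ : ∀ u v d i .(c : Coprime ℤ.∣ i ∣ (suc d)) → i ≡ u ⊖ v →
  code (mkℚ i d c) ≡ ⟦ suc u ≤ v ⟧ ∷ ℤ.∣ i ∣ ∷ suc d ∷ []
code-⊖ u v d i c i≡ with ℕ.<-≤-connex u v
... | inj₂ v≤u with refl ← trans i≡ (ℤ.⊖-≥ v≤u) rewrite ⟦≤⟧-false (ℕ.s≤s v≤u) = refl
... | inj₁ u<v with v ℕ.∸ u | ℕ.m<n⇒0<n∸m u<v | ℤ.⊖-< u<v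
...   | suc _ | _ | ⊖≡ with refl ← trans i≡ ⊖≡ rewrite ⟦≤⟧-true u<v = refl

⊖-≐ : ∀ u v d i .(c : Coprime ℤ.∣ i ∣ (suc d)) → i ≡ u ⊖ v →
  mkℚ i d c * ⌜ suc d ⌝ + ⌜ v ⌝ ≡ ⌜ u ⌝
⊖-≐ u v d i c i≡ with ℕ.<-≤-connex u v
... | inj₂ v≤u with refl ← trans i≡ (ℤ.⊖-≥ v≤u) =
  trans (cong (_+ ⌜ v ⌝) (↥≡*↧ (u ℕ.∸ v) d c))
    (trans (sym (⌜⌝-homo-+ (u ℕ.∸ v) v)) (cong ⌜_⌝ (ℕ.m∸n+n≡m v≤u)))
... | inj₁ u<v with v ℕ.∸ u | ℕ.m<n⇒0<n∸m u<v | ℤ.⊖-< u<v | ℕ.m∸n+n≡m (ℕ.<⇒≤ u<v)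
...   | suc e | _ | ⊖≡ | e+u≡v with refl ← trans i≡ ⊖≡ =
  trans (cong₂ _+_ (trans (sym (neg-distribˡ-* (mkℚ (ℤ.+ suc e) d c) ⌜ suc d ⌝))
      (cong -_ (↥≡*↧ (suc e) d c)))
    (trans (cong ⌜_⌝ (sym e+u≡v)) (⌜⌝-homo-+ (suc e) u)))
  (cancel ⌜ suc e ⌝ ⌜ u ⌝)
  where
  open +-*-Solver
  cancel : ∀ e u → - e + (e + u) ≡ u
  cancel = solve 2 (λ e u → :- e :+ (e :+ u) := u) refl

gridPoint-≐ : ∀ B k N → gridPoint B k N + ⌜ B ⌝ ≐ gridNumerator k N / (suc N ℕ.* suc N)
gridPoint-≐ B k N = fraction (trans (*-distribʳ-+ ⌜ D ⌝ (gridPoint B k N) ⌜ B ⌝)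
  (trans (cong (λ z → gridPoint B k N * ⌜ D ⌝ + z) (sym (⌜⌝-homo-* B D)))
    (⊖-≐ (gridNumerator k N) (B ℕ.* D) (gridDenominator-1 N) _ (grid-coprime B k N) refl)))
  where D = suc N ℕ.* suc N

gridCode : ℕ → ℕ → ℕ → Vec ℕ 3
gridCode B k N = ⟦ suc (gridNumerator k N) ≤ B ℕ.* (suc N ℕ.* suc N) ⟧ ∷ distance (gridNumerator k N) (B ℕ.* (suc N ℕ.* suc N)) ∷
  suc N ℕ.* suc N ∷ []

code-gridPoint : ∀ B k N → code (gridPoint B k N) ≡ gridCode B k N
code-gridPoint B k N = trans (code-⊖ (gridNumerator k N) (B ℕ.* suc (gridDenominator-1 N)) (gridDenominator-1 N) _ (grid-coprime B k N) refl)
  (cong (λ z → ⟦ suc (gridNumerator k N) ≤ B ℕ.* suc (gridDenominator-1 N) ⟧ ∷ z ∷ suc (gridDenominator-1 N) ∷ [])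
    (∣⊖∣≡distance (gridNumerator k N) (B ℕ.* suc (gridDenominator-1 N))))

+-cancelʳ-≤ℚ : ∀ r {p q} → p + r ≤ q + r → p ≤ q
+-cancelʳ-≤ℚ r p+r≤q+r = ≮⇒≥ λ q<p → <⇒≱′ (+-monoˡ-< r q<p) p+r≤q+r
  where
  <⇒≱′ : ∀ {p q} → p < q → ¬ q ≤ p
  <⇒≱′ p<q q≤p = <-irrefl refl (<-≤-trans p<q q≤p)

-- With p + B = P/D < P′/D′ = p′ + B, the grid point (P/D) + 1/N² - B for N = D (D′ + 1) lies between.
grid-dense : ∀ B {p p′} → - ⌜ B ⌝ < p → p < p′ → ∃[ k ] ∃[ N ] p < gridPoint B k N × gridPoint B k N ≤ p′
grid-dense B {p} {p′} -B<p p<p′ = between (nonNegative-≐ (<⇒≤ 0<p+B)) (nonNegative-≐ (<⇒≤ (<-trans 0<p+B p+B<)))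
  where
  0<p+B : 0ℚ < p + ⌜ B ⌝
  0<p+B = subst (_< p + ⌜ B ⌝) (+-inverseˡ ⌜ B ⌝) (+-monoˡ-< ⌜ B ⌝ -B<p)
  p+B< : p + ⌜ B ⌝ < p′ + ⌜ B ⌝
  p+B< = +-monoˡ-< ⌜ B ⌝ p<p′
  between : ∃[ u ] ∃[ d ] p + ⌜ B ⌝ ≐ u / suc d → ∃[ u ] ∃[ d ] p′ + ⌜ B ⌝ ≐ u / suc d →
    ∃[ k ] ∃[ N ] p < gridPoint B k N × gridPoint B k N ≤ p′
  between (P , d , p≐) (P′ , d′ , p′≐) = k , N ,
    +-cancelʳ-<ℚ ⌜ B ⌝ (≐-< p≐ (gridPoint-≐ B k N) lt) ,
    +-cancelʳ-≤ℚ ⌜ B ⌝ (≐-≤ (gridPoint-≐ B k N) p′≐ le)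
    where
    D = suc d
    D′ = suc d′
    M = suc D′
    k = M ℕ.* P
    N = d′ ℕ.+ suc (d ℕ.* M)
    1+N≡ : suc N ≡ D ℕ.* M
    1+N≡ = cong suc (ℕ.+-suc d′ (d ℕ.* M))
    open ℕ.+-*-Solver
    lt : P ℕ.* (suc N ℕ.* suc N) ℕ.< gridNumerator k N ℕ.* D
    lt = subst (λ n → P ℕ.* (n ℕ.* n) ℕ.< suc (k ℕ.* n) ℕ.* D) (sym 1+N≡)
      (subst₂ ℕ._<_ (ℕ.+-identityʳ _) (sym (expand P D M)) (ℕ.+-monoʳ-< (P ℕ.* (D ℕ.* M ℕ.* (D ℕ.* M))) (ℕ.z<s {d})))
      where
      expand : ∀ P D M → suc (M ℕ.* P ℕ.* (D ℕ.* M)) ℕ.* D ≡ P ℕ.* (D ℕ.* M ℕ.* (D ℕ.* M)) ℕ.+ D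
      expand = solve 3 (λ P D M → (con 1 :+ M :* P :* (D :* M)) :* D := P :* (D :* M :* (D :* M)) :+ D) refl
    cross : P ℕ.* D′ ℕ.< P′ ℕ.* D
    cross = ≐-<⁻ p≐ p′≐ p+B<
    -- The gap P′/D′ - P/D is at least 1/(D D′), hence at least the increment 1/(D M)².
    le : gridNumerator k N ℕ.* D′ ℕ.≤ P′ ℕ.* (suc N ℕ.* suc N)
    le = subst (λ n → suc (k ℕ.* n) ℕ.* D′ ℕ.≤ P′ ℕ.* (n ℕ.* n)) (sym 1+N≡) (begin
      suc (M ℕ.* P ℕ.* (D ℕ.* M)) ℕ.* D′          ≡⟨ solve 4 (λ P D M D′ → (con 1 :+ M :* P :* (D :* M)) :* D′
                                                    := P :* D′ :* (D :* (M :* M)) :+ D′) refl P D M D′ ⟩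
      P ℕ.* D′ ℕ.* (D ℕ.* (M ℕ.* M)) ℕ.+ D′        ≤⟨ ℕ.+-monoʳ-≤ (P ℕ.* D′ ℕ.* (D ℕ.* (M ℕ.* M))) D′≤ ⟩
      P ℕ.* D′ ℕ.* (D ℕ.* (M ℕ.* M)) ℕ.+ D ℕ.* (M ℕ.* M) ≡⟨ ℕ.+-comm _ (D ℕ.* (M ℕ.* M)) ⟩
      suc (P ℕ.* D′) ℕ.* (D ℕ.* (M ℕ.* M))        ≤⟨ ℕ.*-monoˡ-≤ (D ℕ.* (M ℕ.* M)) cross ⟩
      P′ ℕ.* D ℕ.* (D ℕ.* (M ℕ.* M))              ≡⟨ solve 3 (λ P′ D M → P′ :* D :* (D :* (M :* M))
                                                    := P′ :* (D :* M :* (D :* M))) refl P′ D M ⟩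
      P′ ℕ.* (D ℕ.* M ℕ.* (D ℕ.* M))              ∎)
      where
      open ℕ.≤-Reasoning
      D′≤ : D′ ℕ.≤ D ℕ.* (M ℕ.* M)
      D′≤ = ℕ.≤-trans (ℕ.n≤1+n D′) (ℕ.≤-trans (ℕ.m≤m*n M M) (ℕ.m≤n*m (M ℕ.* M) D))

-- Enumerating the arguments whose sweep value lies below a left-Π⁰₂ real

Increasing : (ℕ → Bool) → Set
Increasing f = ∀ {s t} → s ℕ.≤ t → f s ≡ true → f t ≡ true

isPos-mono : ∀ {m n} → m ℕ.≤ n → isPos m ≡ true → isPos n ≡ true
isPos-mono m≤n m>0 = isPos⁺ (ℕ.<-≤-trans (isPos⁻ m>0) m≤n)

-- Enumerate x once every grid point q ≤ v x listed before x has passed the tests z < x for q ∈ lower a.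
module CutEnumeration (a : ℝ) (a-leftΠ⁰₂ : LeftΠ⁰₂ a) (B : ℕ) (-B∈a : - ⌜ B ⌝ ∈ lower a)
  (v : ℕ → ℚ) (num den-1 : ℕ → ℕ) (v≐ : ∀ x → v x + ⌜ B ⌝ ≐ num x / suc (den-1 x))
  (num-recursive : Recursive {1} λ xs → num (lookup xs 0F))
  (den-recursive : Recursive {1} λ xs → suc (den-1 (lookup xs 0F))) where

  private
    R = proj₁ a-leftΠ⁰₂

    passed : ℕ → ℕ → ℕ → ℕ → ℕ
    passed k N z s = ∑[ y < s ] 𝟙 (R (z ∷ y ∷ gridCode B k N))

    relevant : ℕ → ℕ → ℕ → ℕ
    relevant k N x = ⟦ gridNumerator k N ℕ.* suc (den-1 x) ≤ num x ℕ.* (suc N ℕ.* suc N) ⟧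

    failure : ℕ → ℕ → ℕ → ℕ → ℕ → ℕ
    failure k N z x s = relevant k N x ℕ.* ⟦ passed k N z s ≤ 0 ⟧

    failures : ℕ → ℕ → ℕ
    failures x s = ∑[ k < x ] ∑[ N < x ] ∑[ z < x ] failure k N z x s

    passed-mono : ∀ k N z {s t} → s ℕ.≤ t → passed k N z s ℕ.≤ passed k N z t
    passed-mono k N z = ∑-mono-range _

    failure-antitone : ∀ k N z x → Antitone (failure k N z x)
    failure-antitone k N z x s≤t = ℕ.*-monoʳ-≤ (relevant k N x)
      (ℕ.∸-monoʳ-≤ 1 (ℕ.∸-monoˡ-≤ 0 (passed-mono k N z s≤t)))

    failures-antitone : ∀ x → Antitone (failures x)
    failures-antitone x s≤t = ∑-mono-≤ x λ k → ∑-mono-≤ x λ N → ∑-mono-≤ x λ z → failure-antitone k N z x s≤t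

    -- The factor `⟦ 1 ≤ s ⟧` delays every enumeration past stage 0, where an approximation must
    -- take the value 0; at x = 0, for instance, there are no tests to wait for.
    stage : ℕ → ℕ → ℕ
    stage x s = ⟦ 1 ≤ s ⟧ ℕ.* ⟦ failures x s ≤ 0 ⟧

    stage-mono : ∀ x {s t} → s ℕ.≤ t → stage x s ℕ.≤ stage x t
    stage-mono x {s} {t} s≤t = ℕ.*-mono-≤
      (ℕ.∸-monoʳ-≤ 1 (ℕ.∸-monoʳ-≤ 1 s≤t))
      (ℕ.∸-monoʳ-≤ 1 (ℕ.∸-monoˡ-≤ 0 (failures-antitone x s≤t)))

  enumerated : ℕ → ℕ → Bool
  enumerated x s = isPos (stage x s)

  enumerated-increasing : ∀ x → Increasing (enumerated x)
  enumerated-increasing x s≤t = isPos-mono (stage-mono x s≤t)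

  enumerated-0 : ∀ x → enumerated x 0 ≡ false
  enumerated-0 x = refl

  enumerated-recursive : Recursive {2} λ xs → 𝟙 (enumerated (lookup xs 0F) (lookup xs 1F))
  enumerated-recursive = 𝟙∘isPosᴿ (⟦ constant 1 ≤ var 1F ⟧ᴿ *ᴿ ⟦ failures-recursive ≤ constant 0 ⟧ᴿ)
    where
    -- the variables are y, z, N, k, x, s
    passed-recursive : Recursive {5} λ xs →
      passed (lookup xs 2F) (lookup xs 1F) (lookup xs 0F) (lookup xs 4F)
    passed-recursive = ∑ᴿ {f = λ xs → 𝟙 (R (lookup xs 1F ∷ lookup xs 0F ∷ gridCode B (lookup xs 3F) (lookup xs 2F)))}
      (var 4F) (comp (proj₁ (proj₂ a-leftΠ⁰₂)) (var 1F ∷ᴿ var 0F ∷ᴿ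
        ⟦ sucᴿ numer ≤ shift ⟧ᴿ ∷ᴿ ((numer ∸ᴿ shift) +ᴿ (shift ∸ᴿ numer)) ∷ᴿ denom ∷ᴿ []ᴿ))
      where
      numer = sucᴿ (var 3F *ᴿ sucᴿ (var 2F))
      denom = sucᴿ (var 2F) *ᴿ sucᴿ (var 2F)
      shift = constant B *ᴿ denom
    failures-recursive : Recursive {2} λ xs → failures (lookup xs 0F) (lookup xs 1F)
    failures-recursive =
      ∑ᴿ {f = λ xs → ∑[ N < lookup xs 1F ] ∑[ z < lookup xs 1F ]
                       failure (lookup xs 0F) N z (lookup xs 1F) (lookup xs 2F)} (var 0F)
      (∑ᴿ {f = λ xs → ∑[ z < lookup xs 2F ]
                       failure (lookup xs 1F) (lookup xs 0F) z (lookup xs 2F) (lookup xs 3F)} (var 1F)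
      (∑ᴿ {f = λ xs → failure (lookup xs 2F) (lookup xs 1F) (lookup xs 0F) (lookup xs 3F) (lookup xs 4F)} (var 2F)
        (⟦ sucᴿ (var 2F *ᴿ sucᴿ (var 1F)) *ᴿ comp den-recursive (var 3F ∷ᴿ []ᴿ)
         ≤ comp num-recursive (var 3F ∷ᴿ []ᴿ) *ᴿ (sucᴿ (var 1F) *ᴿ sucᴿ (var 1F)) ⟧ᴿ
        *ᴿ ⟦ passed-recursive ≤ constant 0 ⟧ᴿ)))

  private
    lower⇔ : ∀ k N → gridPoint B k N ∈ lower a ⇔ (∀ z → ∃[ y ] R (z ∷ y ∷ gridCode B k N) ≡ true)
    lower⇔ k N = subst (λ c → gridPoint B k N ∈ lower a ⇔ (∀ z → ∃[ y ] R (z ∷ y ∷ c) ≡ true))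
      (code-gridPoint B k N) (proj₂ (proj₂ a-leftΠ⁰₂) (gridPoint B k N))

    relevant⁻ : ∀ k N x → 0 ℕ.< relevant k N x → gridPoint B k N ≤ v x
    relevant⁻ k N x 0< = +-cancelʳ-≤ℚ ⌜ B ⌝ (≐-≤ (gridPoint-≐ B k N) (v≐ x) (⟦≤⟧-sound _ _ 0<))

    relevant⁺ : ∀ k N x → gridPoint B k N ≤ v x → relevant k N x ≡ 1
    relevant⁺ k N x q≤ = ⟦≤⟧-true (≐-≤⁻ (gridPoint-≐ B k N) (v≐ x) (+-monoˡ-≤ ⌜ B ⌝ q≤))

    failure-vanishes : ∀ k N z x → v x ∈ lower a → ∃[ s ] failure k N z x s ≡ 0
    failure-vanishes k N z x v∈ = by-cases (relevant k N x) (relevant⁻ k N x)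
      where
      by-cases : ∀ r → (0 ℕ.< r → gridPoint B k N ≤ v x) → ∃[ s ] r ℕ.* ⟦ passed k N z s ≤ 0 ⟧ ≡ 0
      by-cases zero    _  = 0 , refl
      by-cases (suc r) q≤ =
        let y , Ry = to (lower⇔ k N) (lower-closed-≤ a (q≤ ℕ.z<s) v∈) z
            0<passed = ℕ.<-≤-trans (subst (λ b → 0 ℕ.< 𝟙 b) (sym Ry) ℕ.z<s)
              (term≤∑ (λ y → 𝟙 (R (z ∷ y ∷ gridCode B k N))) (ℕ.n<1+n y)) in
        suc y , trans (cong (suc r ℕ.*_) (⟦≤⟧-false 0<passed)) (ℕ.*-zeroʳ (suc r))

  lower⇒enumerated : ∀ x → v x ∈ lower a → ∃[ s ] enumerated x s ≡ true
  lower⇒enumerated x v∈ = let s , eq = vanish in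
    suc s , isPos⁺ (*>0 (ℕ.≤-reflexive (sym (⟦≤⟧-true {1} {suc s} (ℕ.s≤s ℕ.z≤n))))
      (ℕ.≤-reflexive (sym (⟦≤⟧-true (ℕ.≤-trans (failures-antitone x (ℕ.n≤1+n s)) (ℕ.≤-reflexive eq))))))
    where
    vanish : ∃[ s ] failures x s ≡ 0
    vanish = ∑-vanishes x _ (λ k s≤t → ∑-mono-≤ x λ N → ∑-mono-≤ x λ z → failure-antitone k N z x s≤t)
      λ k _ → ∑-vanishes x _ (λ N s≤t → ∑-mono-≤ x λ z → failure-antitone k N z x s≤t)
      λ N _ → ∑-vanishes x _ (λ z → failure-antitone k N z x)
      λ z _ → failure-vanishes k N z x v∈

  private
    persists : ∀ k N z → (∀ y → R (z ∷ y ∷ gridCode B k N) ≡ false) →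
      ∀ x → k ℕ.< x → N ℕ.< x → z ℕ.< x → gridPoint B k N ≤ v x → ∀ s → enumerated x s ≡ false
    persists k N z never x k<x N<x z<x q≤v s = cong isPos
      (trans (cong (⟦ 1 ≤ s ⟧ ℕ.*_) (⟦≤⟧-false failing)) (ℕ.*-zeroʳ ⟦ 1 ≤ s ⟧))
      where
      open ℕ.≤-Reasoning
      passed≡0 : passed k N z s ≡ 0
      passed≡0 = trans (∑-cong s (λ y _ → cong 𝟙 (never y))) (trans (∑-const s 0) (ℕ.*-zeroʳ s))
      failing : 0 ℕ.< failures x s
      failing = begin-strict
        0                                           <⟨ ℕ.z<s ⟩
        1                                           ≡⟨ cong₂ ℕ._*_ (relevant⁺ k N x q≤v)
                                                         (⟦≤⟧-true (ℕ.≤-reflexive passed≡0)) ⟨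
        failure k N z x s                           ≤⟨ term≤∑ (λ z → failure k N z x s) z<x ⟩
        ∑[ z < x ] failure k N z x s                ≤⟨ term≤∑ (λ N → ∑[ z < x ] failure k N z x s) N<x ⟩
        ∑[ N < x ] ∑[ z < x ] failure k N z x s     ≤⟨ term≤∑ (λ k → ∑[ N < x ] ∑[ z < x ] failure k N z x s) k<x ⟩
        failures x s                                ∎

  module _ (em : ExcludedMiddle 0ℓ) where

    private
      refutation : ∀ k N → gridPoint B k N ∉ lower a → ∃[ z ] (∀ y → R (z ∷ y ∷ gridCode B k N) ≡ false)
      refutation k N q∉ = from-dec em
        where
        Found : ℕ → Set
        Found z = ∃[ y ] R (z ∷ y ∷ gridCode B k N) ≡ true
        found : ¬ (∃[ z ] (∀ y → R (z ∷ y ∷ gridCode B k N) ≡ false)) → ∀ z → Dec (Found z) → Found z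
        found ¬c z (yes w) = w
        found ¬c z (no ¬w) = contradiction (z , λ y → ¬-not (λ eq → ¬w (y , eq))) ¬c
        from-dec : Dec (∃[ z ] (∀ y → R (z ∷ y ∷ gridCode B k N) ≡ false)) →
          ∃[ z ] (∀ y → R (z ∷ y ∷ gridCode B k N) ≡ false)
        from-dec (yes c) = c
        from-dec (no ¬c) = contradiction (from (lower⇔ k N) (λ z → found ¬c z em)) q∉

    -- Between a and u there is room for a grid point q ≤ u above a. Some test z of q never passes,
    -- and it blocks every x beyond the indices of q and z with `v x` at least u.
    upper⇒unenumerated : ∀ {u} → u ∈ upper a →
      ∃[ M ] (∀ x → M ℕ.≤ x → u ≤ v x → ∀ s → enumerated x s ≡ false)
    upper⇒unenumerated {u} u∈ =
      let p , p<u , p∈ = upper-open a u∈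
          k , N , p<q , q≤u = grid-dense B (lower<upper a -B∈a p∈) p<u
          z , never = refutation k N (λ q∈ → <-irrefl refl (lower<upper a q∈ (upper-closed a p<q p∈))) in
      suc (k ℕ.⊔ N ℕ.⊔ z) , λ x M≤x u≤v → persists k N z never x
        (ℕ.≤-<-trans (ℕ.≤-trans (ℕ.m≤m⊔n k N) (ℕ.m≤m⊔n _ z)) M≤x)
        (ℕ.≤-<-trans (ℕ.≤-trans (ℕ.m≤n⊔m k N) (ℕ.m≤m⊔n _ z)) M≤x)
        (ℕ.≤-<-trans (ℕ.m≤n⊔m (k ℕ.⊔ N) z) M≤x)
        (≤-trans q≤u u≤v)

-- Differences of two enumerations

module _ (em : ExcludedMiddle 0ℓ) where

  Enumerable : (ℕ → Bool) → Set
  Enumerable κ = ∃[ s ] κ s ≡ true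

  limit : (ℕ → Bool) → Bool
  limit κ = does (em {Enumerable κ})

  limit-true : ∀ κ → ∃[ s ] κ s ≡ true → limit κ ≡ true
  limit-true κ e with em {Enumerable κ}
  ... | yes _ = refl
  ... | no ¬e = contradiction e ¬e

  limit-false : ∀ κ → (∀ s → κ s ≡ false) → limit κ ≡ false
  limit-false κ never with em {Enumerable κ}
  ... | no _ = refl
  ... | yes (s , κs) with () ← trans (sym κs) (never s)

  limit-settles : ∀ κ → Increasing κ → ∃[ t ] (∀ s → t ℕ.≤ s → κ s ≡ limit κ)
  limit-settles κ κ↑ with em {Enumerable κ}
  ... | yes (t , κt) = t , λ s t≤s → κ↑ t≤s κt
  ... | no ¬e = 0 , λ s _ → ¬-not (λ κs → ¬e (s , κs))

  module _ (κ ƛ : ℕ → ℕ → Bool) (κ↑ : ∀ x → Increasing (κ x)) (ƛ↑ : ∀ x → Increasing (ƛ x))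
           (κ-0 : ∀ x → κ x 0 ≡ false)
           (κ-recursive : Recursive {2} λ xs → 𝟙 (κ (lookup xs 0F) (lookup xs 1F)))
           (ƛ-recursive : Recursive {2} λ xs → 𝟙 (ƛ (lookup xs 0F) (lookup xs 1F))) where

    difference : Subsetℕ
    difference x = limit (κ x) ∧ not (limit (ƛ x))

    private
      g : Vec ℕ 2 → Bool
      g xs = κ (lookup xs 0F) (lookup xs 1F) ∧ not (ƛ (lookup xs 0F) (lookup xs 1F))

      𝟙-∧-not : ∀ a b → 𝟙 (a ∧ not b) ≡ 𝟙 a ℕ.∸ 𝟙 b
      𝟙-∧-not true  true  = refl
      𝟙-∧-not true  false = refl
      𝟙-∧-not false true  = refl
      𝟙-∧-not false false = refl

      g-settles : ∀ x → ∃[ t ] (∀ s → t ℕ.≤ s → g (x ∷ s ∷ []) ≡ difference x)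
      g-settles x with limit-settles (κ x) (κ↑ x) | limit-settles (ƛ x) (ƛ↑ x)
      ... | t , κ≡ | u , ƛ≡ = t ℕ.⊔ u , λ s t⊔u≤s → cong₂ (λ a b → a ∧ not b)
        (κ≡ s (ℕ.≤-trans (ℕ.m≤m⊔n t u) t⊔u≤s)) (ƛ≡ s (ℕ.≤-trans (ℕ.m≤n⊔m t u) t⊔u≤s))

      change≤ : ∀ a a′ b b′ → (a ≡ true → a′ ≡ true) → (b ≡ true → b′ ≡ true) →
        𝟙 a ℕ.+ 𝟙 b ℕ.+ 𝟙 ((a ∧ not b) xor (a′ ∧ not b′)) ℕ.≤ 𝟙 a′ ℕ.+ 𝟙 b′
      change≤ true  false _     _     a⇒ _ with () ← a⇒ refl
      change≤ _     _     true  false _ b⇒ with () ← b⇒ refl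
      change≤ true  true  true  true  _ _ = ℕ.≤-refl
      change≤ true  true  false true  _ _ = ℕ.≤-refl
      change≤ true  true  false false _ _ = ℕ.≤-refl
      change≤ false true  true  true  _ _ = ℕ.n≤1+n 1
      change≤ false true  false true  _ _ = ℕ.z≤n
      change≤ false true  false false _ _ = ℕ.≤-refl
      change≤ false false true  true  _ _ = ℕ.≤-refl
      change≤ false false false true  _ _ = ℕ.z≤n
      change≤ false false false false _ _ = ℕ.≤-refl

      -- each change of g is paid for by an enumeration into one of the two sets
      changes≤ : ∀ x s → ∑[ t < s ] 𝟙 (g (x ∷ t ∷ []) xor g (x ∷ suc t ∷ [])) ℕ.≤ 𝟙 (κ x s) ℕ.+ 𝟙 (ƛ x s)
      changes≤ x zero    = ℕ.z≤n
      changes≤ x (suc s) = ℕ.≤-trans (ℕ.+-monoˡ-≤ _ (changes≤ x s))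
        (change≤ (κ x s) (κ x (suc s)) (ƛ x s) (ƛ x (suc s)) (κ↑ x (ℕ.n≤1+n s)) (ƛ↑ x (ℕ.n≤1+n s)))

    difference-CE : ∀ {n} → 2 ℕ.≤ n → CE n difference
    difference-CE 2≤n = g ,
      ext (κ-recursive ∸ᴿ ƛ-recursive) (λ xs → 𝟙-∧-not (κ (lookup xs 0F) (lookup xs 1F)) _) ,
      λ x → cong (_∧ not (ƛ x 0)) (κ-0 x) , g-settles x , λ m →
        ℕ.≤-trans (ℕ.≤-reflexive (∣↾∣≡∑ _ m)) (ℕ.≤-trans (changes≤ x m)
          (ℕ.≤-trans (ℕ.+-mono-≤ (𝟙≤1 (κ x m)) (𝟙≤1 (ƛ x m))) 2≤n))

≐-+ : ∀ {p p′ u u′ w w′} → p ≐ u / w → p′ ≐ u′ / w′ →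
  p + p′ ≐ u ℕ.* w′ ℕ.+ u′ ℕ.* w / (w ℕ.* w′)
≐-+ {p} {p′} {u} {u′} {w} {w′} (fraction p≐) (fraction p′≐) = fraction (begin
  (p + p′) * ⌜ w ℕ.* w′ ⌝                     ≡⟨ cong ((p + p′) *_) (⌜⌝-homo-* w w′) ⟩
  (p + p′) * (⌜ w ⌝ * ⌜ w′ ⌝)                 ≡⟨ expand p p′ ⌜ w ⌝ ⌜ w′ ⌝ ⟩
  p * ⌜ w ⌝ * ⌜ w′ ⌝ + p′ * ⌜ w′ ⌝ * ⌜ w ⌝    ≡⟨ cong₂ _+_ (cong (_* ⌜ w′ ⌝) p≐) (cong (_* ⌜ w ⌝) p′≐) ⟩
  ⌜ u ⌝ * ⌜ w′ ⌝ + ⌜ u′ ⌝ * ⌜ w ⌝             ≡⟨ cong₂ _+_ (⌜⌝-homo-* u w′) (⌜⌝-homo-* u′ w) ⟨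
  ⌜ u ℕ.* w′ ⌝ + ⌜ u′ ℕ.* w ⌝                 ≡⟨ ⌜⌝-homo-+ (u ℕ.* w′) (u′ ℕ.* w) ⟨
  ⌜ u ℕ.* w′ ℕ.+ u′ ℕ.* w ⌝                   ∎)
  where
  open ≡-Reasoning
  expand : ∀ p q w v → (p + q) * (w * v) ≡ p * w * v + q * v * w
  expand = solve 4 (λ p q w v → (p :+ q) :* (w :* v) := p :* w :* v :+ q :* v :* w) refl
    where open +-*-Solver

⌜⌝-≐ : ∀ n → ⌜ n ⌝ ≐ n / 1
⌜⌝-≐ n = fraction (*-identityʳ ⌜ n ⌝)

-- abstract, so that the conversion checker never computes the gcd inside _/_
abstract

  ratio : ℕ → ℕ → ℚ
  ratio u w = ℤ.+ u / suc w

  ratio-≐ : ∀ u w → ratio u w ≐ u / suc w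
  ratio-≐ = /-≐

-- Enclosing a real between multiples of 1/Q

module Brackets (c : ℚ) (q : ℕ) where

  Q = suc q

  point : ℕ → ℚ
  point i = c + ratio i q

  abstract
    point-mono-< : ∀ {i j} → i ℕ.< j → point i < point j
    point-mono-< {i} {j} i<j = +-monoʳ-< c (≐-< (ratio-≐ i q) (ratio-≐ j q) (ℕ.*-monoˡ-< Q i<j))

  -- Locatedness decides only between two neighbouring points, so the bracket spans up to two steps.
  -- The bounds by Q are what `Equidistribution` asks of its ratios.
  record Bracket (x : ℝ) : Set where
    field
      i k    : ℕ
      i≤Q    : i ℕ.≤ Q
      k≤Q    : k ℕ.≤ Q
      k≤i+2  : k ℕ.≤ i ℕ.+ 2
      lower∋ : point i ∈ lower x
      upper∋ : point k ∈ upper x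

  abstract

    narrow : ∀ x → c ∈ lower x → c + 1ℚ ∈ upper x → Bracket x
    narrow x c∈ c+1∈ = climb Q 0 (ℕ.+-identityʳ Q) (lower-closed-≤ x
        (subst (point 0 ≤_) (+-identityʳ c) (+-monoʳ-≤ c (≐-≤ (ratio-≐ 0 q) (⌜⌝-≐ 0) ℕ.z≤n))) c∈)
      where
      Q∈ : point Q ∈ upper x
      Q∈ = upper-closed-≤ x (+-monoʳ-≤ c (≐-≤ (⌜⌝-≐ 1) (ratio-≐ Q q)
        (ℕ.≤-reflexive (ℕ.*-comm 1 Q)))) c+1∈
      close : ∀ fuel i → suc fuel ℕ.+ i ≡ Q → point i ∈ lower x → point (suc (suc i)) ∈ upper x → Bracket x
      -- Here i + 2 is Q + 1, outside the range; Q itself lies above x and closes the bracket.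
      close zero i eq i∈ _ = record
        { i = i ; k = Q
        ; i≤Q = ℕ.≤-trans (ℕ.n≤1+n i) (ℕ.≤-reflexive eq)
        ; k≤Q = ℕ.≤-refl
        ; k≤i+2 = ℕ.≤-trans (ℕ.≤-reflexive (sym eq)) (ℕ.≤-trans (ℕ.n≤1+n (suc i)) (ℕ.≤-reflexive (ℕ.+-comm 2 i)))
        ; lower∋ = i∈ ; upper∋ = Q∈ }
      close (suc fuel) i eq i∈ i+2∈ = record
        { i = i ; k = suc (suc i)
        ; i≤Q = ℕ.≤-trans (ℕ.m≤n+m i (suc (suc fuel))) (ℕ.≤-reflexive eq)
        ; k≤Q = ℕ.≤-trans (ℕ.m≤n+m (suc (suc i)) fuel) (ℕ.≤-reflexive
            (trans (trans (ℕ.+-suc fuel (suc i)) (cong suc (ℕ.+-suc fuel i))) eq))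
        ; k≤i+2 = ℕ.≤-reflexive (ℕ.+-comm 2 i)
        ; lower∋ = i∈ ; upper∋ = i+2∈ }
      climb : ∀ fuel i → fuel ℕ.+ i ≡ Q → point i ∈ lower x → Bracket x
      climb zero i refl i∈ = contradiction (lower<upper x i∈ Q∈) (<-irrefl refl)
      climb (suc fuel) i eq i∈ = Sum.[ climb fuel (suc i) (trans (ℕ.+-suc fuel i) eq) , close fuel i eq i∈ ]′
        (located x (point-mono-< (ℕ.n<1+n (suc i))))

-- Error terms that vanish against m

∑-eventually-≤ : ∀ {f g} K M → (∀ x → f x ℕ.≤ K) → (∀ x → M ℕ.≤ x → f x ℕ.≤ g x) →
  ∀ m → ∑ m f ℕ.≤ ∑ m g ℕ.+ K ℕ.* M
∑-eventually-≤ {f} {g} K M f≤K f≤g m with ℕ.≤-total m M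
... | inj₁ m≤M = ℕ.≤-trans (ℕ.≤-trans (∑-mono-≤ m f≤K) (ℕ.≤-reflexive (trans (∑-const m K) (ℕ.*-comm m K))))
  (ℕ.≤-trans (ℕ.*-monoʳ-≤ K m≤M) (ℕ.m≤n+m (K ℕ.* M) (∑ m g)))
... | inj₂ M≤m = go (ℕ.≤⇒≤′ M≤m)
  where
  go : ∀ {m} → M ℕ.≤′ m → ∑ m f ℕ.≤ ∑ m g ℕ.+ K ℕ.* M
  go ℕ.≤′-refl = ℕ.≤-trans (ℕ.≤-trans (∑-mono-≤ M f≤K) (ℕ.≤-reflexive (trans (∑-const M K) (ℕ.*-comm M K))))
    (ℕ.m≤n+m (K ℕ.* M) (∑ M g))
  go {suc m} (ℕ.≤′-step M≤m) = ℕ.≤-trans (ℕ.+-mono-≤ (go M≤m) (f≤g m (ℕ.≤′⇒≤ M≤m)))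
    (ℕ.≤-reflexive (swap (∑ m g) (K ℕ.* M) (g m)))
    where
    swap : ∀ a b c → a ℕ.+ b ℕ.+ c ≡ a ℕ.+ c ℕ.+ b
    swap = solve 3 (λ a b c → a :+ b :+ c := a :+ c :+ b) refl
      where open ℕ.+-*-Solver

≤isqrt : ∀ {h m} → h ℕ.* h ℕ.≤ m → h ℕ.≤ isqrt m
≤isqrt {h} {m} h²≤m = ℕ.≮⇒≥ λ s<h → ℕ.<⇒≱ (m< (isqrt m) (offset+isqrt² m) (offset<blockLength m))
  (ℕ.≤-trans (ℕ.*-mono-≤ s<h s<h) h²≤m)
  where
  m< : ∀ s {j} → m ≡ j ℕ.+ s ℕ.* s → j ℕ.< suc (2 ℕ.* s) → m ℕ.< suc s ℕ.* suc s
  m< s {j} m≡ j< = subst₂ ℕ._<_ (sym m≡) (square s) (ℕ.+-monoˡ-< (s ℕ.* s) j<)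
    where
    square : ∀ s → suc (2 ℕ.* s) ℕ.+ s ℕ.* s ≡ suc s ℕ.* suc s
    square = solve 1 (λ s → con 1 :+ con 2 :* s :+ s :* s := (con 1 :+ s) :* (con 1 :+ s)) refl
      where open ℕ.+-*-Solver

-- With s = `isqrt m` ≥ h ≥ 1, the sum 3s + 2 + G is at most (G + 5) s, and h is chosen so that 8E
-- (G + 5) s = 4hs ≤ 4s² ≤ 4m.
error-negligible : ∀ E G m → 1 ℕ.≤ E → let h = 2 ℕ.* E ℕ.* (G ℕ.+ 5) in h ℕ.* h ℕ.≤ m →
  8 ℕ.* E ℕ.* (3 ℕ.* isqrt m ℕ.+ 2 ℕ.+ G) ℕ.≤ 4 ℕ.* m
error-negligible E G m 1≤E h²≤m = begin
  8 ℕ.* E ℕ.* (3 ℕ.* s ℕ.+ 2 ℕ.+ G)  ≤⟨ ℕ.*-monoʳ-≤ (8 ℕ.* E) absorb ⟩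
  8 ℕ.* E ℕ.* (s ℕ.* (G ℕ.+ 5))      ≡⟨ rearrange E s (G ℕ.+ 5) ⟩
  4 ℕ.* (h ℕ.* s)                    ≤⟨ ℕ.*-monoʳ-≤ 4 (ℕ.≤-trans (ℕ.*-monoˡ-≤ s h≤s) (isqrt²≤ m)) ⟩
  4 ℕ.* m                            ∎
  where
  open ℕ.≤-Reasoning
  open ℕ.+-*-Solver
  s = isqrt m
  h = 2 ℕ.* E ℕ.* (G ℕ.+ 5)
  rearrange : ∀ E s G → 8 ℕ.* E ℕ.* (s ℕ.* G) ≡ 4 ℕ.* (2 ℕ.* E ℕ.* G ℕ.* s)
  rearrange = solve 3 (λ E s G → con 8 :* E :* (s :* G) := con 4 :* (con 2 :* E :* G :* s)) refl
  h≤s : h ℕ.≤ s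
  h≤s = ≤isqrt {h} {m} h²≤m
  1≤s : 1 ℕ.≤ s
  1≤s = ℕ.≤-trans (*>0 {2 ℕ.* E} (*>0 {2} ℕ.z<s 1≤E) (ℕ.≤-trans (ℕ.s≤s ℕ.z≤n) (ℕ.m≤n+m 5 G))) h≤s
  collect : ∀ s G → 3 ℕ.* s ℕ.+ 2 ℕ.* s ℕ.+ G ℕ.* s ≡ s ℕ.* (G ℕ.+ 5)
  collect = solve 2 (λ s G → con 3 :* s :+ con 2 :* s :+ G :* s := s :* (G :+ con 5)) refl
  absorb : 3 ℕ.* s ℕ.+ 2 ℕ.+ G ℕ.≤ s ℕ.* (G ℕ.+ 5)
  absorb = ℕ.≤-trans (ℕ.+-mono-≤ (ℕ.+-monoʳ-≤ (3 ℕ.* s) (ℕ.*-monoʳ-≤ 2 1≤s))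
      (ℕ.≤-trans (ℕ.≤-reflexive (sym (ℕ.*-identityʳ G))) (ℕ.*-monoʳ-≤ G 1≤s)))
    (ℕ.≤-reflexive (collect s G))

fraction-of-block : ℕ → ℚ
fraction-of-block x = ratio (offset x) (2 ℕ.* isqrt x)

sweep : ℚ → ℕ → ℚ
sweep c x = c + fraction-of-block x

-- The density of the difference of two approximate initial segments of the sweep

module Density (a b : ℝ) (b≤a : ∀ {p} → p ∈ upper a → p ∉ lower b)
  (c : ℚ) (c∈a : c ∈ lower a) (c∈b : c ∈ lower b) (c+1∈a : c + 1ℚ ∈ upper a) (c+1∈b : c + 1ℚ ∈ upper b)
  (κ ƛ : ℕ → Bool)
  (lower⇒κ : ∀ x → sweep c x ∈ lower a → κ x ≡ true)
  (upper⇒¬κ : ∀ {u} → u ∈ upper a → ∃[ M ] (∀ x → M ℕ.≤ x → u ≤ sweep c x → κ x ≡ false))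
  (lower⇒ƛ : ∀ x → sweep c x ∈ lower b → ƛ x ≡ true)
  (upper⇒¬ƛ : ∀ {u} → u ∈ upper b → ∃[ M ] (∀ x → M ℕ.≤ x → u ≤ sweep c x → ƛ x ≡ false)) where

  private
    v : ℕ → ℚ
    v = sweep c

  A : Subsetℕ
  A x = κ x ∧ not (ƛ x)

  -- Of the 8 steps of length 1/Q that make up the tolerance 1/(E+1), each of the two brackets uses
  -- 2; discrepancy and finitely many exceptions share the other 4.
  module _ (E q : ℕ) (Q≡8E : suc q ≡ 8 ℕ.* suc E) where

    private
      open Brackets c q

      module BA = Bracket (narrow a c∈a c+1∈a)
      module BB = Bracket (narrow b c∈b c+1∈b)

      count : ℕ → ℕ → ℕ
      count P = below-ratio P Q

      data Side (P x : ℕ) : Set where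
        left  : count P x ≡ 1 → v x < point P → Side P x
        right : count P x ≡ 0 → point P ≤ v x → Side P x

      side : ∀ P x → Side P x
      side P x = by-cases (suc (offset x ℕ.* Q) ℕ.≤? P ℕ.* blockLength x)
        where
        θ≐ : fraction-of-block x ≐ offset x / blockLength x
        θ≐ = ratio-≐ (offset x) (2 ℕ.* isqrt x)
        P≐ : ratio P q ≐ P / Q
        P≐ = ratio-≐ P q
        by-cases : Dec (suc (offset x ℕ.* Q) ℕ.≤ P ℕ.* blockLength x) → Side P x
        by-cases (yes lt) = left (⟦≤⟧-true lt) (+-monoʳ-< c (≐-< θ≐ P≐ lt))
        by-cases (no ¬lt) = right (⟦≤⟧-false (ℕ.≰⇒> ¬lt)) (+-monoʳ-≤ c (≐-≤ P≐ θ≐ (ℕ.≤-pred (ℕ.≰⇒> ¬lt))))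

      count≤1 : ∀ P x → count P x ℕ.≤ 1
      count≤1 P x = ℕ.m∸n≤m 1 (suc (offset x ℕ.* Q) ℕ.∸ P ℕ.* blockLength x)

      M-κ = upper⇒¬κ BA.upper∋
      M-ƛ = upper⇒¬ƛ BB.upper∋
      M = proj₁ M-κ ℕ.⊔ proj₁ M-ƛ

      κ-false : ∀ x → M ℕ.≤ x → point BA.k ≤ v x → κ x ≡ false
      κ-false x M≤x = proj₂ M-κ x (ℕ.≤-trans (ℕ.m≤m⊔n (proj₁ M-κ) (proj₁ M-ƛ)) M≤x)

      ƛ-false : ∀ x → M ℕ.≤ x → point BB.k ≤ v x → ƛ x ≡ false
      ƛ-false x M≤x = proj₂ M-ƛ x (ℕ.≤-trans (ℕ.m≤n⊔m (proj₁ M-κ) (proj₁ M-ƛ)) M≤x)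

      κ-true : ∀ x → v x < point BA.i → κ x ≡ true
      κ-true x <i = lower⇒κ x (lower-closed a <i BA.lower∋)

      ƛ-true : ∀ x → v x < point BB.i → ƛ x ≡ true
      ƛ-true x <i = lower⇒ƛ x (lower-closed b <i BB.lower∋)

      𝟙A : ℕ → ℕ
      𝟙A x = 𝟙 (κ x ∧ not (ƛ x))

      -- Past M, a member of A has its value below `point BA.k`, and values below `point BB.i` are
      -- removed through ƛ. The two counts subtract because b ≤ a forbids a value at least
      -- `point BA.k` yet below `point BB.i`.
      A-upper : ∀ x → M ℕ.≤ x → 𝟙A x ℕ.+ count BB.i x ℕ.≤ count BA.k x
      A-upper x M≤x with side BB.i x | side BA.k x
      ... | left  i≡ <i | left  k≡ _ rewrite i≡ | k≡ | ƛ-true x <i = ℕ.≤-reflexive (cong (λ z → 𝟙 z ℕ.+ 1) (∧-zeroʳ (κ x)))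
      ... | left  i≡ <i | right k≡ k≤ = contradiction BB.lower∋ (b≤a (upper-closed a (≤-<-trans k≤ <i) BA.upper∋))
      ... | right i≡ _  | left  k≡ _ rewrite i≡ | k≡ = ℕ.≤-trans (ℕ.≤-reflexive (ℕ.+-identityʳ _)) (𝟙≤1 _)
      ... | right i≡ _  | right k≡ k≤ rewrite i≡ | k≡ | κ-false x M≤x k≤ = ℕ.z≤n

      A-lower : ∀ x → M ℕ.≤ x → count BA.i x ℕ.≤ 𝟙A x ℕ.+ count BB.k x
      A-lower x M≤x with side BA.i x | side BB.k x
      ... | right i≡ _  | _ rewrite i≡ = ℕ.z≤n
      ... | left  i≡ _  | left k≡ _ rewrite i≡ | k≡ = ℕ.m≤n+m 1 (𝟙A x)
      ... | left  i≡ <i | right k≡ k≤ rewrite i≡ | k≡ | κ-true x <i | ƛ-false x M≤x k≤ = ℕ.≤-refl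

      D : ℕ → ℕ → ℕ
      D P m = ∑[ x < m ] count P x

      -- Each of the first M arguments may violate the pointwise bounds, by at most 2.
      G = 2 ℕ.* M

      ∣A∣≡ : ∀ m → ∣ A ↾ m ∣ ≡ ∑ m 𝟙A
      ∣A∣≡ = ∣↾∣≡∑ A

      total-upper : ∀ m → ∣ A ↾ m ∣ ℕ.+ D BB.i m ℕ.≤ D BA.k m ℕ.+ G
      total-upper m = subst (ℕ._≤ D BA.k m ℕ.+ G)
        (trans (∑-distrib-+ m 𝟙A (count BB.i)) (cong (ℕ._+ D BB.i m) (sym (∣A∣≡ m))))
        (∑-eventually-≤ 2 M (λ x → ℕ.+-mono-≤ (𝟙≤1 _) (count≤1 BB.i x)) A-upper m)

      total-lower : ∀ m → D BA.i m ℕ.≤ ∣ A ↾ m ∣ ℕ.+ D BB.k m ℕ.+ G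
      total-lower m = subst (λ z → D BA.i m ℕ.≤ z ℕ.+ G)
        (trans (∑-distrib-+ m 𝟙A (count BB.k)) (cong (ℕ._+ D BB.k m) (sym (∣A∣≡ m))))
        (∑-eventually-≤ 2 M (λ x → ℕ.≤-trans (count≤1 BA.i x) (ℕ.n≤1+n 1)) A-lower m)

      threshold = 2 ℕ.* suc E ℕ.* (G ℕ.+ 5)

      module _ (m : ℕ) (large : threshold ℕ.* threshold ℕ.≤ m) where

        error : ℕ
        error = Q ℕ.* (3 ℕ.* isqrt m ℕ.+ 2)

        error≤ : error ℕ.+ Q ℕ.* G ℕ.≤ 4 ℕ.* m
        error≤ = ℕ.≤-trans (ℕ.≤-reflexive (sym (ℕ.*-distribˡ-+ Q (3 ℕ.* isqrt m ℕ.+ 2) G)))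
          (subst (λ Q → Q ℕ.* (3 ℕ.* isqrt m ℕ.+ 2 ℕ.+ G) ℕ.≤ 4 ℕ.* m) (sym Q≡8E)
            (error-negligible (suc E) G m (ℕ.s≤s ℕ.z≤n) large))

        D-lower : ∀ {P} → P ℕ.≤ Q → P ℕ.* m ℕ.≤ Q ℕ.* D P m
        D-lower {P} P≤Q = Equidistribution.count-lower P Q P≤Q m

        D-upper : ∀ {P} → P ℕ.≤ Q → Q ℕ.* D P m ℕ.≤ P ℕ.* m ℕ.+ error
        D-upper {P} P≤Q = Equidistribution.count-upper P Q P≤Q m

        open ℕ.≤-Reasoning
        open ℕ.+-*-Solver

        -- Q |A| ≤ (k_a - i_b + 4) m and (i_a - k_b - 4) m ≤ Q |A|, the differences being moved across
        card-upper : Q ℕ.* ∣ A ↾ m ∣ ℕ.+ BB.i ℕ.* m ℕ.≤ (BA.k ℕ.+ 4) ℕ.* m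
        card-upper = begin
          Q ℕ.* ∣ A ↾ m ∣ ℕ.+ BB.i ℕ.* m        ≤⟨ ℕ.+-monoʳ-≤ (Q ℕ.* ∣ A ↾ m ∣) (D-lower BB.i≤Q) ⟩
          Q ℕ.* ∣ A ↾ m ∣ ℕ.+ Q ℕ.* D BB.i m    ≡⟨ ℕ.*-distribˡ-+ Q ∣ A ↾ m ∣ (D BB.i m) ⟨
          Q ℕ.* (∣ A ↾ m ∣ ℕ.+ D BB.i m)        ≤⟨ ℕ.*-monoʳ-≤ Q (total-upper m) ⟩
          Q ℕ.* (D BA.k m ℕ.+ G)                ≡⟨ ℕ.*-distribˡ-+ Q (D BA.k m) G ⟩
          Q ℕ.* D BA.k m ℕ.+ Q ℕ.* G            ≤⟨ ℕ.+-monoˡ-≤ (Q ℕ.* G) (D-upper BA.k≤Q) ⟩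
          BA.k ℕ.* m ℕ.+ error ℕ.+ Q ℕ.* G      ≡⟨ ℕ.+-assoc (BA.k ℕ.* m) error (Q ℕ.* G) ⟩
          BA.k ℕ.* m ℕ.+ (error ℕ.+ Q ℕ.* G)    ≤⟨ ℕ.+-monoʳ-≤ (BA.k ℕ.* m) error≤ ⟩
          BA.k ℕ.* m ℕ.+ 4 ℕ.* m                ≡⟨ ℕ.*-distribʳ-+ m BA.k 4 ⟨
          (BA.k ℕ.+ 4) ℕ.* m                    ∎

        card-lower : BA.i ℕ.* m ℕ.≤ Q ℕ.* ∣ A ↾ m ∣ ℕ.+ (BB.k ℕ.+ 4) ℕ.* m
        card-lower = begin
          BA.i ℕ.* m                                                ≤⟨ D-lower BA.i≤Q ⟩
          Q ℕ.* D BA.i m                                            ≤⟨ ℕ.*-monoʳ-≤ Q (total-lower m) ⟩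
          Q ℕ.* (∣ A ↾ m ∣ ℕ.+ D BB.k m ℕ.+ G)                      ≡⟨ distrib Q ∣ A ↾ m ∣ (D BB.k m) G ⟩
          Q ℕ.* ∣ A ↾ m ∣ ℕ.+ (Q ℕ.* D BB.k m ℕ.+ Q ℕ.* G)          ≤⟨ ℕ.+-monoʳ-≤ (Q ℕ.* ∣ A ↾ m ∣)
                                                                       (ℕ.+-monoˡ-≤ (Q ℕ.* G) (D-upper BB.k≤Q)) ⟩
          Q ℕ.* ∣ A ↾ m ∣ ℕ.+ (BB.k ℕ.* m ℕ.+ error ℕ.+ Q ℕ.* G)    ≡⟨ cong (Q ℕ.* ∣ A ↾ m ∣ ℕ.+_)
                                                                       (ℕ.+-assoc (BB.k ℕ.* m) error (Q ℕ.* G)) ⟩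
          Q ℕ.* ∣ A ↾ m ∣ ℕ.+ (BB.k ℕ.* m ℕ.+ (error ℕ.+ Q ℕ.* G))  ≤⟨ ℕ.+-monoʳ-≤ (Q ℕ.* ∣ A ↾ m ∣)
                                                                       (ℕ.+-monoʳ-≤ (BB.k ℕ.* m) error≤) ⟩
          Q ℕ.* ∣ A ↾ m ∣ ℕ.+ (BB.k ℕ.* m ℕ.+ 4 ℕ.* m)              ≡⟨ cong (Q ℕ.* ∣ A ↾ m ∣ ℕ.+_) (ℕ.*-distribʳ-+ m BB.k 4) ⟨
          Q ℕ.* ∣ A ↾ m ∣ ℕ.+ (BB.k ℕ.+ 4) ℕ.* m                    ∎
          where
          distrib : ∀ q a d g → q ℕ.* (a ℕ.+ d ℕ.+ g) ≡ q ℕ.* a ℕ.+ (q ℕ.* d ℕ.+ q ℕ.* g)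
          distrib = solve 4 (λ q a d g → q :* (a :+ d :+ g) := q :* a :+ (q :* d :+ q :* g)) refl

        -- Placing ρ - ε below a - b requires a point below a and a point above b, so `BA.k` and
        -- `BB.i` are exchanged for `BA.i` and `BB.k` at two steps each: 8 = 4 + 2 + 2.
        cross-upper : Q ℕ.* ∣ A ↾ m ∣ ℕ.+ BB.k ℕ.* m ℕ.≤ (BA.i ℕ.+ 8) ℕ.* m
        cross-upper = begin
          Q ℕ.* ∣ A ↾ m ∣ ℕ.+ BB.k ℕ.* m            ≤⟨ ℕ.+-monoʳ-≤ (Q ℕ.* ∣ A ↾ m ∣) (ℕ.*-monoˡ-≤ m BB.k≤i+2) ⟩
          Q ℕ.* ∣ A ↾ m ∣ ℕ.+ (BB.i ℕ.+ 2) ℕ.* m    ≡⟨ split (Q ℕ.* ∣ A ↾ m ∣) BB.i m ⟩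
          Q ℕ.* ∣ A ↾ m ∣ ℕ.+ BB.i ℕ.* m ℕ.+ 2 ℕ.* m ≤⟨ ℕ.+-monoˡ-≤ (2 ℕ.* m) card-upper ⟩
          (BA.k ℕ.+ 4) ℕ.* m ℕ.+ 2 ℕ.* m            ≤⟨ ℕ.+-monoˡ-≤ (2 ℕ.* m) (ℕ.*-monoˡ-≤ m (ℕ.+-monoˡ-≤ 4 BA.k≤i+2)) ⟩
          (BA.i ℕ.+ 2 ℕ.+ 4) ℕ.* m ℕ.+ 2 ℕ.* m      ≡⟨ solve 2 (λ i m → (i :+ con 2 :+ con 4) :* m :+ con 2 :* m
                                                        := (i :+ con 8) :* m) refl BA.i m ⟩
          (BA.i ℕ.+ 8) ℕ.* m                        ∎
          where
          split : ∀ a i m → a ℕ.+ (i ℕ.+ 2) ℕ.* m ≡ a ℕ.+ i ℕ.* m ℕ.+ 2 ℕ.* m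
          split = solve 3 (λ a i m → a :+ (i :+ con 2) :* m := a :+ i :* m :+ con 2 :* m) refl

        cross-lower : BA.k ℕ.* m ℕ.≤ Q ℕ.* ∣ A ↾ m ∣ ℕ.+ (BB.i ℕ.+ 8) ℕ.* m
        cross-lower = begin
          BA.k ℕ.* m                                            ≤⟨ ℕ.*-monoˡ-≤ m BA.k≤i+2 ⟩
          (BA.i ℕ.+ 2) ℕ.* m                                    ≡⟨ ℕ.*-distribʳ-+ m BA.i 2 ⟩
          BA.i ℕ.* m ℕ.+ 2 ℕ.* m                                ≤⟨ ℕ.+-monoˡ-≤ (2 ℕ.* m) card-lower ⟩
          Q ℕ.* ∣ A ↾ m ∣ ℕ.+ (BB.k ℕ.+ 4) ℕ.* m ℕ.+ 2 ℕ.* m    ≤⟨ ℕ.+-monoˡ-≤ (2 ℕ.* m) (ℕ.+-monoʳ-≤ (Q ℕ.* ∣ A ↾ m ∣)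
                                                                   (ℕ.*-monoˡ-≤ m (ℕ.+-monoˡ-≤ 4 BB.k≤i+2))) ⟩
          Q ℕ.* ∣ A ↾ m ∣ ℕ.+ (BB.i ℕ.+ 2 ℕ.+ 4) ℕ.* m ℕ.+ 2 ℕ.* m ≡⟨ solve 3 (λ a i m →
                                                                   a :+ (i :+ con 2 :+ con 4) :* m :+ con 2 :* m
                                                                   := a :+ (i :+ con 8) :* m) refl (Q ℕ.* ∣ A ↾ m ∣) BB.i m ⟩
          Q ℕ.* ∣ A ↾ m ∣ ℕ.+ (BB.i ℕ.+ 8) ℕ.* m                ∎

    private
      -- 1/E = 8/Q
      rescale-upper : ∀ e Q n m i k → Q ≡ 8 ℕ.* e → Q ℕ.* n ℕ.+ k ℕ.* m ℕ.≤ (i ℕ.+ 8) ℕ.* m →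
        (n ℕ.* Q ℕ.+ k ℕ.* m) ℕ.* (Q ℕ.* e) ℕ.≤ (i ℕ.* e ℕ.+ 1 ℕ.* Q) ℕ.* (m ℕ.* Q)
      rescale-upper e Q n m i k refl le = begin
        (n ℕ.* Q ℕ.+ k ℕ.* m) ℕ.* (Q ℕ.* e)   ≡⟨ cong (λ z → (z ℕ.+ k ℕ.* m) ℕ.* (Q ℕ.* e)) (ℕ.*-comm n Q) ⟩
        (Q ℕ.* n ℕ.+ k ℕ.* m) ℕ.* (Q ℕ.* e)   ≤⟨ ℕ.*-monoˡ-≤ (Q ℕ.* e) le ⟩
        (i ℕ.+ 8) ℕ.* m ℕ.* (Q ℕ.* e)         ≡⟨ solve 3 (λ e m i → (i :+ con 8) :* m :* (con 8 :* e :* e)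
                                                  := (i :* e :+ con 1 :* (con 8 :* e)) :* (m :* (con 8 :* e))) refl e m i ⟩
        (i ℕ.* e ℕ.+ 1 ℕ.* Q) ℕ.* (m ℕ.* Q)   ∎
        where
        open ℕ.≤-Reasoning
        open ℕ.+-*-Solver

      rescale-lower : ∀ e Q n m i k → Q ≡ 8 ℕ.* e → k ℕ.* m ℕ.≤ Q ℕ.* n ℕ.+ (i ℕ.+ 8) ℕ.* m →
        k ℕ.* (m ℕ.* (Q ℕ.* e)) ℕ.≤ (n ℕ.* (Q ℕ.* e) ℕ.+ (i ℕ.* e ℕ.+ 1 ℕ.* Q) ℕ.* m) ℕ.* Q
      rescale-lower e Q n m i k refl le = begin
        k ℕ.* (m ℕ.* (Q ℕ.* e))                        ≡⟨ ℕ.*-assoc k m (Q ℕ.* e) ⟨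
        k ℕ.* m ℕ.* (Q ℕ.* e)                          ≤⟨ ℕ.*-monoˡ-≤ (Q ℕ.* e) le ⟩
        (Q ℕ.* n ℕ.+ (i ℕ.+ 8) ℕ.* m) ℕ.* (Q ℕ.* e)    ≡⟨ solve 4 (λ e n m i →
          (con 8 :* e :* n :+ (i :+ con 8) :* m) :* (con 8 :* e :* e)
          := (n :* (con 8 :* e :* e) :+ (i :* e :+ con 1 :* (con 8 :* e)) :* m) :* (con 8 :* e)) refl e n m i ⟩
        (n ℕ.* (Q ℕ.* e) ℕ.+ (i ℕ.* e ℕ.+ 1 ℕ.* Q) ℕ.* m) ℕ.* Q ∎
        where
        open ℕ.≤-Reasoning
        open ℕ.+-*-Solver

    record Approximation (m : ℕ) .{{_ : ℕ.NonZero m}} : Set where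
      field
        i k i′ k′ : ℕ
        i∈  : point i ∈ lower a
        k∈  : point k ∈ upper a
        i′∈ : point i′ ∈ lower b
        k′∈ : point k′ ∈ upper b
        ρ≤  : ρ m A + ratio k′ q ≤ ratio i q + ratio 1 E
        ≤ρ  : ratio k q ≤ ρ m A + (ratio i′ q + ratio 1 E)

    approximation : ∃[ T ] (∀ m .{{_ : ℕ.NonZero m}} → T ℕ.≤ m → Approximation m)
    approximation = threshold ℕ.* threshold , bounds
      where
      bounds : ∀ m .{{_ : ℕ.NonZero m}} → threshold ℕ.* threshold ℕ.≤ m → Approximation m
      bounds m@(suc m-1) large = record
        { i = BA.i ; k = BA.k ; i′ = BB.i ; k′ = BB.k
        ; i∈ = BA.lower∋ ; k∈ = BA.upper∋ ; i′∈ = BB.lower∋ ; k′∈ = BB.upper∋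
        ; ρ≤ = ≐-≤ (≐-+ (/-≐ n m-1) (ratio-≐ BB.k q)) (≐-+ (ratio-≐ BA.i q) (ratio-≐ 1 E))
            (rescale-upper (suc E) Q n m BA.i BB.k Q≡8E (cross-upper m large))
        ; ≤ρ = ≐-≤ (ratio-≐ BA.k q) (≐-+ (/-≐ n m-1) (≐-+ (ratio-≐ BB.i q) (ratio-≐ 1 E)))
            (rescale-lower (suc E) Q n m BB.i BA.k Q≡8E (cross-lower m large)) }
        where n = ∣ A ↾ m ∣

reciprocal-below : ∀ {ε} → 0ℚ < ε → ∃[ E ] ratio 1 E ≤ ε
reciprocal-below {ε} 0<ε = extract (archimedean 1ℚ ε {{positive 0<ε}})
  where
  extract : ∃[ k ] 1ℚ < ⌜ k ⌝ * ε → ∃[ E ] ratio 1 E ≤ ε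
  extract (zero  , 1<0) = contradiction (<-trans (subst (1ℚ <_) (*-zeroˡ ε) 1<0) (positive⁻¹ 1ℚ)) (<-irrefl refl)
  extract (suc E , 1<Eε) = E , *-cancelʳ-≤-pos ⌜ suc E ⌝ (subst₂ _≤_
    (sym (_≐_/_.cleared (ratio-≐ 1 E))) (*-comm ⌜ suc E ⌝ ε) (<⇒≤ 1<Eε))

-- The 2-c.e. set of density a - b

module Construction (em : ExcludedMiddle 0ℓ) (a b : ℝ) (a-leftΠ⁰₂ : LeftΠ⁰₂ a) (b-leftΠ⁰₂ : LeftΠ⁰₂ b)
  (b≤a : ∀ {p} → p ∈ upper a → p ∉ lower b)
  (c : ℚ) (c∈a : c ∈ lower a) (c∈b : c ∈ lower b) (c+1∈a : c + 1ℚ ∈ upper a) (c+1∈b : c + 1ℚ ∈ upper b)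
  (B : ℕ) (-B<c : - ⌜ B ⌝ < c) where

  private
    c+B-fraction : ∃[ u ] ∃[ w ] c + ⌜ B ⌝ ≐ u / suc w
    c+B-fraction = nonNegative-≐ (<⇒≤ (subst (_< c + ⌜ B ⌝) (+-inverseˡ ⌜ B ⌝) (+-monoˡ-< ⌜ B ⌝ -B<c)))

    u w : ℕ
    u = proj₁ c+B-fraction
    w = proj₁ (proj₂ c+B-fraction)

    v : ℕ → ℚ
    v = sweep c

    num den-1 : ℕ → ℕ
    -- Cross-multiplied sum of `offset x / blockLength x` and c + B = u/(w+1); `suc (den-1 x)`
    -- reduces to `blockLength x * suc w`.
    num x = offset x ℕ.* suc w ℕ.+ u ℕ.* blockLength x
    den-1 x = w ℕ.+ 2 ℕ.* isqrt x ℕ.* suc w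

    v≐ : ∀ x → v x + ⌜ B ⌝ ≐ num x / suc (den-1 x)
    v≐ x = subst (_≐ num x / suc (den-1 x)) (rearrange (fraction-of-block x) c ⌜ B ⌝)
      (≐-+ (ratio-≐ (offset x) (2 ℕ.* isqrt x)) (proj₂ (proj₂ c+B-fraction)))
      where
      open +-*-Solver
      rearrange : ∀ t c b → t + (c + b) ≡ c + t + b
      rearrange = solve 3 (λ t c b → t :+ (c :+ b) := c :+ t :+ b) refl

    num-recursive : Recursive {1} λ xs → num (lookup xs 0F)
    num-recursive = offsetᴿ (var 0F) *ᴿ constant (suc w) +ᴿ constant u *ᴿ blockLengthᴿ (var 0F)

    den-recursive : Recursive {1} λ xs → suc (den-1 (lookup xs 0F))
    den-recursive = blockLengthᴿ (var 0F) *ᴿ constant (suc w)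

    module K = CutEnumeration a a-leftΠ⁰₂ B (lower-closed a -B<c c∈a) v num den-1 v≐ num-recursive den-recursive
    module L = CutEnumeration b b-leftΠ⁰₂ B (lower-closed b -B<c c∈b) v num den-1 v≐ num-recursive den-recursive

    κ ƛ : ℕ → Bool
    κ x = limit em (K.enumerated x)
    ƛ x = limit em (L.enumerated x)

    κ-lower : ∀ x → v x ∈ lower a → κ x ≡ true
    κ-lower x v∈ = limit-true em (K.enumerated x) (K.lower⇒enumerated x v∈)

    ƛ-lower : ∀ x → v x ∈ lower b → ƛ x ≡ true
    ƛ-lower x v∈ = limit-true em (L.enumerated x) (L.lower⇒enumerated x v∈)

    κ-upper : ∀ {u} → u ∈ upper a → ∃[ M ] (∀ x → M ℕ.≤ x → u ≤ v x → κ x ≡ false)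
    κ-upper u∈ = let M , never = K.upper⇒unenumerated em u∈ in
      M , λ x M≤x u≤v → limit-false em (K.enumerated x) (never x M≤x u≤v)

    ƛ-upper : ∀ {u} → u ∈ upper b → ∃[ M ] (∀ x → M ℕ.≤ x → u ≤ v x → ƛ x ≡ false)
    ƛ-upper u∈ = let M , never = L.upper⇒unenumerated em u∈ in
      M , λ x M≤x u≤v → limit-false em (L.enumerated x) (never x M≤x u≤v)

    module Dens = Density a b b≤a c c∈a c∈b c+1∈a c+1∈b κ ƛ κ-lower κ-upper ƛ-lower ƛ-upper

  A : Subsetℕ
  A = Dens.A

  A-CE : ∀ {n} → 2 ℕ.≤ n → CE n A
  A-CE = difference-CE em K.enumerated L.enumerated K.enumerated-increasing L.enumerated-increasing
    K.enumerated-0 K.enumerated-recursive L.enumerated-recursive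

  A-density : HasDensity A (a -ʳ b)
  A-density ε 0<ε = M , λ m M≤m → bounds m (close m M≤m)
    where
    E = proj₁ (reciprocal-below 0<ε)
    1/E≤ε = proj₂ (reciprocal-below 0<ε)
    -- `suc (E + 7 * suc E)` is definitionally `8 * suc E`, hence the proof `refl`.
    M = proj₁ (Dens.approximation E (E ℕ.+ 7 ℕ.* suc E) refl)
    close = proj₂ (Dens.approximation E (E ℕ.+ 7 ℕ.* suc E) refl)
    neg-involutive : ∀ p → - - p ≡ p
    neg-involutive p = solve 1 (λ p → :- (:- p) := p) refl p
      where open +-*-Solver
    bounds : ∀ m .{{_ : ℕ.NonZero m}} → Dens.Approximation E (E ℕ.+ 7 ℕ.* suc E) refl m →
      ρ m A - ε ∈ lower (a -ʳ b) × ρ m A + ε ∈ upper (a -ʳ b)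
    bounds m approx =
      lower-closed-≤ (a -ʳ b) (from-ρ≤ (ρ m A) (ratio _ _) (ratio _ _) (≤-trans ρ≤ (+-monoʳ-≤ (ratio _ _) 1/E≤ε)))
        (_ , _ , i∈ , subst (upper b) (sym (neg-involutive _)) k′∈ , refl) ,
      upper-closed-≤ (a -ʳ b) (from-≤ρ (ρ m A) (ratio _ _) (ratio _ _)
          (≤-trans ≤ρ (+-monoʳ-≤ (ρ m A) (+-monoʳ-≤ (ratio _ _) 1/E≤ε))))
        (_ , _ , k∈ , subst (lower b) (sym (neg-involutive _)) i′∈ , refl)
      where
      open Dens.Approximation approx
      open +-*-Solver
      from-ρ≤ : ∀ p i k → p + k ≤ i + ε → p - ε ≤ c + i - (c + k)
      from-ρ≤ p i k le = subst₂ _≤_ (eq₁ p k ε) (eq₂ c i k ε) (+-monoˡ-≤ (- k - ε) le)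
        where
        eq₁ : ∀ p k e → p + k + (- k - e) ≡ p - e
        eq₁ = solve 3 (λ p k e → p :+ k :+ (:- k :- e) := p :- e) refl
        eq₂ : ∀ c i k e → i + e + (- k - e) ≡ c + i - (c + k)
        eq₂ = solve 4 (λ c i k e → i :+ e :+ (:- k :- e) := c :+ i :- (c :+ k)) refl
      from-≤ρ : ∀ p k i → k ≤ p + (i + ε) → c + k - (c + i) ≤ p + ε
      from-≤ρ p k i le = subst₂ _≤_ (eq₁ c k i) (eq₂ p i ε) (+-monoˡ-≤ (- i) le)
        where
        eq₁ : ∀ c k i → k - i ≡ c + k - (c + i)
        eq₁ = solve 3 (λ c k i → k :- i := c :+ k :- (c :+ i)) refl
        eq₂ : ∀ p i e → p + (i + e) - i ≡ p + e
        eq₂ = solve 3 (λ p i e → p :+ (i :+ e) :- i := p :+ e) refl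

-- Assembling the equivalence

HasDensity-resp-≈ : ∀ {X r s} → r ≈ s → HasDensity X s → HasDensity X r
HasDensity-resp-≈ (lower⇔ , upper⇔) density ε 0<ε = let M , bounds = density ε 0<ε in
  M , λ m M≤m → let l , u = bounds m M≤m in from (lower⇔ _) l , from (upper⇔ _) u

everything : Subsetℕ
everything _ = true

everything-CE : ∀ {n} → 1 ℕ.≤ n → CE n everything
everything-CE {n} 1≤n = (λ xs → isPos (lookup xs 1F)) , 𝟙∘isPosᴿ (var 1F) , λ x → refl ,
  (1 , λ { (suc s) _ → refl }) , λ m → ℕ.≤-trans (ℕ.≤-reflexive (∣↾∣≡∑ _ m)) (ℕ.≤-trans (one-change m) 1≤n)
  where
  one-change : ∀ m → ∑[ s < m ] 𝟙 (isPos s xor true) ℕ.≤ 1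
  one-change zero          = ℕ.z≤n
  one-change (suc zero)    = ℕ.≤-refl
  one-change (suc (suc m)) = subst (ℕ._≤ 1) (sym (ℕ.+-identityʳ _)) (one-change (suc m))

everything-density : ∀ {r} → 1ℚ ∉ upper r → 1ℚ ∉ lower r → HasDensity everything r
everything-density {r} 1∉u 1∉l ε 0<ε = 0 , λ m _ → subst (λ p → p - ε ∈ lower r × p + ε ∈ upper r) (sym (ρ≡1 m))
  (below (located r (subst (1ℚ - ε <_) (+-identityʳ 1ℚ) (+-monoʳ-< 1ℚ (neg-antimono-< 0<ε)))) ,
   above (located r (subst (_< 1ℚ + ε) (+-identityʳ 1ℚ) (+-monoʳ-< 1ℚ 0<ε))))
  where
  below : 1ℚ - ε ∈ lower r ⊎ 1ℚ ∈ upper r → 1ℚ - ε ∈ lower r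
  below (inj₁ l) = l
  below (inj₂ u) = contradiction u 1∉u
  above : 1ℚ ∈ lower r ⊎ 1ℚ + ε ∈ upper r → 1ℚ + ε ∈ upper r
  above (inj₁ l) = contradiction l 1∉l
  above (inj₂ u) = u
  ρ≡1 : ∀ m .{{_ : ℕ.NonZero m}} → ρ m everything ≡ 1ℚ
  ρ≡1 m@(suc _) = ≤-antisym (ρ≤1 m everything) (*-cancelʳ-≤-pos ⌜ m ⌝ (≤-reflexive (begin
    1ℚ * ⌜ m ⌝                 ≡⟨ *-identityˡ ⌜ m ⌝ ⟩
    ⌜ m ⌝                      ≡⟨ cong ⌜_⌝ (trans (∑-const m 1) (ℕ.*-identityʳ m)) ⟨
    ⌜ ∑[ _ < m ] 1 ⌝           ≡⟨ cong ⌜_⌝ (∣↾∣≡∑ everything m) ⟨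
    ⌜ ∣ everything ↾ m ∣ ⌝     ≡⟨ ρ-*-cancel m everything ⟨
    ρ m everything * ⌜ m ⌝     ∎)))
    where open ≡-Reasoning

𝓓₂⇒density : ExcludedMiddle 0ℓ → ∀ {n} → 2 ℕ.≤ n → ∀ r → r ∈[0,1] → 𝓓₂ r → IsDensityOfCE n r
𝓓₂⇒density em {n} 2≤n r (0∉ , 1∉) (a , b , a-leftΠ⁰₂ , b-leftΠ⁰₂ , r≈a-b@(lower⇔ , upper⇔)) = by-cases em
  where
  -- A rational p above a and below b would put 0 = p - p above a - b, against r ≥ 0.
  b≤a : ∀ {p} → p ∈ upper a → p ∉ lower b
  b≤a {p} p∈a p∈b = 0∉ (from (upper⇔ 0ℚ) (p , - p , p∈a ,
    subst (lower b) (solve 1 (λ p → p := :- (:- p)) refl p) p∈b , sym (+-inverseʳ p)))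
    where open +-*-Solver

  -- The witness that 1 lies above a - b is itself the window: c = - t is below b and c + 1 = s is
  -- above a. Openness gives room to apply locatedness, and b ≤ a then puts c below a and c + 1
  -- above b.
  construct : (∃[ s ] ∃[ t ] s ∈ upper a × - t ∈ lower b × 1ℚ ≡ s + t) → IsDensityOfCE n r
  construct (s , t , s∈a , -t∈b , 1≡s+t) =
    let c = - t
        c+1≡s = trans (cong (- t +_) 1≡s+t) (solve 2 (λ s t → :- t :+ (s :+ t) := s) refl s t)
        c₀ , c<c₀ , c₀∈b = lower-open b -t∈b
        s₀ , s₀<s , s₀∈a = upper-open a s∈a
        B , t<B = <⌜⌝ t
        module C = Construction em a b a-leftΠ⁰₂ b-leftΠ⁰₂ b≤a c
          (lower-a (located a c<c₀) c₀∈b) -t∈b (subst (upper a) (sym c+1≡s) s∈a)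
          (subst (upper b) (sym c+1≡s) (upper-b (located b s₀<s) s₀∈a)) B (neg-antimono-< t<B) in
    C.A , C.A-CE 2≤n , HasDensity-resp-≈ {C.A} {r} {a -ʳ b} r≈a-b C.A-density
    where
    open +-*-Solver
    lower-a : ∀ {p q} → p ∈ lower a ⊎ q ∈ upper a → q ∈ lower b → p ∈ lower a
    lower-a (inj₁ p∈) _  = p∈
    lower-a (inj₂ q∈) q∈b = contradiction q∈b (b≤a q∈)
    upper-b : ∀ {p q} → p ∈ lower b ⊎ q ∈ upper b → p ∈ upper a → q ∈ upper b
    upper-b (inj₁ p∈) p∈a = contradiction p∈ (b≤a p∈a)
    upper-b (inj₂ q∈) _   = q∈

  by-cases : Dec (1ℚ ∈ upper r) → IsDensityOfCE n r
  by-cases (yes 1∈) = construct (to (upper⇔ 1ℚ) 1∈)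
  by-cases (no 1∉u) = everything , everything-CE (ℕ.≤-trans (ℕ.n≤1+n 1) 2≤n) , everything-density {r} 1∉u 1∉

density⇔𝓓₂ : ExcludedMiddle 0ℓ → ∀ {n} → 2 ℕ.≤ n → ∀ r → IsDensityOfCE n r ⇔ (r ∈[0,1] × 𝓓₂ r)
density⇔𝓓₂ em {n} 2≤n r = mk⇔
  (λ { (A , A-CE , density) → density∈[0,1] {A} {r} density , FromCE.density∈𝓓₂ em n A A-CE r density })
  (λ { (r∈ , r∈𝓓₂) → 𝓓₂⇒density em 2≤n r r∈ r∈𝓓₂ })

corollary4p3 : ExcludedMiddle 0ℓ → (n : ℕ) → 2 ℕ.≤ n →
    (∀ r → IsDensityOfCE n r ⇔ (r ∈[0,1] × 𝓓₂ r)) ×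
    (∀ r → IsDensityOfCE n r ⇔ IsDensityOfCE 2 r)
corollary4p3 em n 2≤n = density⇔𝓓₂ em 2≤n , λ r → mk⇔
  (λ density → from (density⇔𝓓₂ em ℕ.≤-refl r) (to (density⇔𝓓₂ em 2≤n r) density))
  (λ density → from (density⇔𝓓₂ em 2≤n r) (to (density⇔𝓓₂ em ℕ.≤-refl r) density))
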